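{- Let $G$ be a graph with odd girth at least $11$ and let $X\subseteq V(G)$ satisfy $\chi(G[X])\ge 99525$. Then $G$ contains a $5$-arithmetic rope all of whose vertices lie in $X$; that is, there are vertices $q_1,\dots,q_5\in X$ and paths $Q_{i,1},Q_{i,2}$ ($1\le i\le 5$) in $G[X]$ such that, with indices modulo $5$: for each $i$, $Q_{i,1}$ is a path of odd length and $Q_{i,2}$ a path of even length between $q_i$ and $q_{i+1}$; for every $(h_1,\dots,h_5)\in\{1,2\}^5$, $Q_{1,h_1}\cup\cdots\cup Q_{5,h_5}$ is an induced cycle of $G$; and $q_1,\dots,q_5$ are pairwise at distance at least $5$ in $G$.
   Context: All graphs are finite and simple. The odd girth of a graph is the length of a shortest odd cycle. $\chi(G[X])$ is the chromatic number of the subgraph induced by $X$. Length of a path is its number of edges. -}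

module Defs where

open import Data.Nat using (ℕ; zero; suc; _+_; _*_; _<_; _≤_)
open import Data.Nat.DivMod using (_%_; m%n<n)
open import Data.Fin using (Fin; zero; suc; toℕ; fromℕ<; inject₁)
open import Data.Fin.Subset using (Subset; _∈_)
open import Data.Product using (Σ; ∃; _×_; _,_)
open import Data.Sum using (_⊎_)
open import Data.Empty using (⊥)
open import Relation.Nullary using (¬_; Dec)
open import Relation.Binary.PropositionalEquality using (_≡_; _≢_)
open import Function.Definitions using (Injective)
open import Function.Bundles using (_⇔_)

record Graph : Set₁ where
  field
    n      : ℕ
    Adj    : Fin n → Fin n → Set
    adj?   : ∀ u v → Dec (Adj u v)
    sym    : ∀ {u v} → Adj u v → Adj v u
    irrefl : ∀ {u} → ¬ Adj u u

open Graph public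

Odd : ℕ → Set
Odd ℓ = ∃ λ k → ℓ ≡ suc (2 * k)

Even : ℕ → Set
Even ℓ = ∃ λ k → ℓ ≡ 2 * k

cnext : ∀ {m} → Fin (suc m) → Fin (suc m)
cnext {m} i = fromℕ< (m%n<n (suc (toℕ i)) (suc m))

record IsPath (G : Graph) (ℓ : ℕ) (p : Fin (suc ℓ) → Fin (n G)) : Set where
  field
    distinct : Injective _≡_ _≡_ p
    steps    : ∀ (i : Fin ℓ) → Adj G (p (inject₁ i)) (p (suc i))

IsPathBetween : (G : Graph) (ℓ : ℕ) → (Fin (suc ℓ) → Fin (n G)) → Fin (n G) → Fin (n G) → Set
IsPathBetween G ℓ p a b = IsPath G ℓ p × (p zero ≡ a) × (p (Data.Fin.fromℕ ℓ) ≡ b)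

VertexOfPath : ∀ {N ℓ} → (Fin (suc ℓ) → Fin N) → Fin N → Set
VertexOfPath {ℓ = ℓ} p v = ∃ λ (i : Fin (suc ℓ)) → p i ≡ v

EdgeOfPath : ∀ {N ℓ} → (Fin (suc ℓ) → Fin N) → Fin N → Fin N → Set
EdgeOfPath {ℓ = ℓ} p u v = ∃ λ (i : Fin ℓ) →
  ((p (inject₁ i) ≡ u) × (p (suc i) ≡ v)) ⊎ ((p (inject₁ i) ≡ v) × (p (suc i) ≡ u))

PathInside : ∀ {N ℓ} → Subset N → (Fin (suc ℓ) → Fin N) → Set
PathInside {ℓ = ℓ} X p = ∀ (i : Fin (suc ℓ)) → p i ∈ X

record IsCycle (G : Graph) (m : ℕ) (c : Fin (suc m) → Fin (n G)) : Set where
  field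
    long     : 2 ≤ m
    distinct : Injective _≡_ _≡_ c
    steps    : ∀ i → Adj G (c i) (c (cnext i))

OddGirth≥ : Graph → ℕ → Set
OddGirth≥ G g = ∀ m (c : Fin (suc m) → Fin (n G)) → IsCycle G m c → Odd (suc m) → g ≤ suc m

ColourableOn : (G : Graph) → Subset (n G) → ℕ → Set
ColourableOn G X k = Σ (Fin (n G) → Fin k) λ f →
  ∀ u v → u ∈ X → v ∈ X → Adj G u v → f u ≢ f v

χ[_[_]]≥_ : (G : Graph) → Subset (n G) → ℕ → Set
χ[ G [ X ]]≥ k = ∀ j → j < k → ¬ ColourableOn G X j

-- Subgraph (S, F) (vertex set S, edge relation F) is an induced cycle of G:
-- (S,F) is a cycle (a cyclic listing of exactly S, length ≥ 3, whose
-- consecutive pairs are exactly the edges F) and every G-edge inside S is in F.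

IsInducedCycle : (G : Graph) → (Fin (n G) → Set) → (Fin (n G) → Fin (n G) → Set) → Set
IsInducedCycle G S F =
  (Σ ℕ λ m → Σ (Fin (suc m) → Fin (n G)) λ c →
      (2 ≤ m)
    × Injective _≡_ _≡_ c
    × (∀ v → S v ⇔ (∃ λ i → c i ≡ v))
    × (∀ u v → F u v ⇔ (∃ λ i → ((c i ≡ u) × (c (cnext i) ≡ v)) ⊎ ((c i ≡ v) × (c (cnext i) ≡ u)))))
  × (∀ u v → S u → S v → Adj G u v → F u v)

Dist≥ : (G : Graph) → Fin (n G) → Fin (n G) → ℕ → Set
Dist≥ G u v d = ∀ ℓ → ℓ < d → (p : Fin (suc ℓ) → Fin (n G)) → ¬ IsPathBetween G ℓ p u v

-- 5-arithmetic rope in G with all vertices in X.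
-- Indices i : Fin 5 are taken modulo 5 (via cnext);
-- h : Fin 2 with zero ↔ "1" (odd path) and suc zero ↔ "2" (even path).

record ArithRope5 (G : Graph) (X : Subset (n G)) : Set where
  field
    q       : Fin 5 → Fin (n G)
    q∈X     : ∀ i → q i ∈ X
    len     : Fin 5 → Fin 2 → ℕ
    Q       : ∀ i h → Fin (suc (len i h)) → Fin (n G)
    Q-path  : ∀ i h → IsPathBetween G (len i h) (Q i h) (q i) (q (cnext i))
    Q-in-X  : ∀ i h → PathInside X (Q i h)
    Q-odd   : ∀ i → Odd (len i zero)
    Q-even  : ∀ i → Even (len i (suc zero))
    induced : ∀ (hs : Fin 5 → Fin 2) →
      IsInducedCycle G
        (λ v → ∃ λ i → VertexOfPath (Q i (hs i)) v)
        (λ u v → ∃ λ i → EdgeOfPath (Q i (hs i)) u v)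
    far     : ∀ i j → i ≢ j → Dist≥ G (q i) (q j) 5

{-# OPTIONS --safe #-}
module Submission where

-- The rope is grown one link at a time from a vertex q. Alongside the chain of links from q to v we keep
-- a set D entered from v and a set X of vertices that lead back to q while avoiding the chain, such that
-- the part of D with a neighbour in X still has large chromatic number. Odd girth at least 11 makes balls
-- of radius 4 bipartite, so deleting one costs two colours.
--
-- To add a link, take a breadth-first level A of D from v, and let η w be the lowest tree level that
-- w ∈ A reaches through one vertex of X or of the preceding level. Restrict A to one parity of η, delete
-- the strict local minima of η (a stable set) and keep a component of what is left. Around a vertex u of
-- least η and a neighbour k with η k ≤ η u, the two paths down to v have lengths of opposite parity when
-- both are continued to u; short case analysis extends them to a vertex b adjacent to a large component of
-- the rest, where the absence of 3- and 5-cycles makes the paths induced. Vertices of X next to the rest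
-- reach only tree levels at least η u, so, apart from bounded balls, they do not touch the new link.
--
-- After five links, any vertex of D with a neighbour in X closes the chain, and the closing path is
-- absorbed into one of the links.

open import Defs hiding (sym)
open import Data.Empty using (⊥; ⊥-elim)
open import Data.Fin using (Fin; zero; suc; toℕ; fromℕ; fromℕ<; inject₁)
open import Data.Fin.Properties using (any?; all?; toℕ<n; toℕ-fromℕ; toℕ-fromℕ<; toℕ-inject₁; toℕ-injective) renaming (_≟_ to _≟ᶠ_; suc-injective to sucᶠ-injective)
open import Data.Fin.Relation.Unary.Top using (view; ‵fromℕ; ‵inject₁)
open import Data.Fin.Subset using (Subset; _∈_; _∪_; _⊂_; ⁅_⁆; ∣_∣)
open import Data.Fin.Subset.Properties using (_∈?_; ∣p∣≤n; p⊂q⇒∣p∣<∣q∣; x∈⁅x⁆; x∈⁅y⁆⇒x≡y; x∈p∪q⁺; x∈p∪q⁻)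
open import Data.List using (List; []; _∷_; _++_; length; lookup)
open import Data.List.Membership.Propositional using () renaming (_∈_ to _∈ˡ_)
open import Data.List.Membership.Propositional.Properties using (∈-++⁺ˡ; ∈-++⁺ʳ; ∈-++⁻; ∈-lookup)
open import Data.List.Properties using (length-++)
open import Data.List.Relation.Unary.All as All using (All; []; _∷_)
import Data.List.Relation.Unary.All.Properties as All
open import Data.List.Relation.Unary.AllPairs using (AllPairs; []; _∷_)
open import Data.List.Relation.Unary.Any as Any using (Any; here; there)
import Data.List.Relation.Unary.Any.Properties as Any
open import Data.List.Relation.Unary.Unique.Propositional using (Unique)
open import Data.List.Relation.Unary.Unique.Propositional.Properties using (++⁺)
open import Data.Nat using (ℕ; zero; suc; _+_; _*_; _∸_; _⊓_; _≤_; _<_; z≤n; s≤s)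
open import Data.Nat.DivMod using (_%_; m<n⇒m%n≡m; n%n≡0; m%n<n)
open import Data.Nat.Induction using (<-wellFounded)
open import Data.Nat.Properties
open import Data.Product using (Σ; ∃; _×_; _,_; proj₁; proj₂)
open import Data.Sum using (_⊎_; inj₁; inj₂; [_,_]′; swap)
open import Data.Vec as Vec using (Vec; []; _∷_)
open import Data.Vec.Properties using (lookup∘tabulate)
open import Function.Bundles using (_⇔_; mk⇔; Equivalence)
open import Induction.WellFounded using (Acc; acc)
open import Relation.Binary.Definitions using (tri<; tri≈; tri>)
open import Relation.Binary.PropositionalEquality using (_≡_; _≢_; refl; sym; trans; cong; subst; subst₂)
open import Relation.Nullary using (¬_; Dec; yes; no; contradiction)
open import Relation.Nullary.Decidable using (¬?; _×-dec_; _⊎-dec_; _→-dec_; map′; decidable-stable)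
open import Relation.Unary using (Decidable)

-- The obstacle is the set X. Its vertices must stay usable for closing the cycle, yet nothing
-- limits where they meet the tree down to v through which the next link has to run. Letting paths
-- through X count in η turns these contacts into candidates for the link itself, and starting from
-- a lowest one leaves no contact below it. The girth bound comes from the corners. Pairwise
-- distance 5 calls for deleting balls of radius 4, and an edge that spoils the parity colouring of
-- such a ball closes an odd walk of length at most 4 + 1 + 4 = 9. Passing to a component, or to one
-- level inside a parity class of levels, costs no colours, because no edge joins two different
-- pieces. Only halvings and deletions cost. Read backwards, a link turns a demand of c colours into
-- 54 + 4c, so five links starting from 0 demand 18414, and the initial state raises this to 36838.

-- Finite search and least witnesses.

anyVec? : ∀ {c} k {P : Vec (Fin c) k → Set} → Decidable P → Dec (∃ P)
anyVec? zero P? = map′ (λ p → [] , p) (λ { ([] , p) → p }) (P? [])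
anyVec? (suc k) P? =
  map′ (λ { (x , xs , p) → x ∷ xs , p }) (λ { (x ∷ xs , p) → x , xs , p })
       (any? λ x → anyVec? k λ xs → P? (x ∷ xs))

-- Serves to give a component a canonical name. A total function into `ℕ` makes names of
-- neighbouring vertices directly comparable.
leastIndex : ∀ {k} {P : Fin k → Set} → Decidable P → ℕ
leastIndex {zero} P? = 0
leastIndex {suc k} P? with P? zero
... | yes _ = 0
... | no  _ = suc (leastIndex (λ i → P? (suc i)))

leastIndex-cong : ∀ {k} {P Q : Fin k → Set} (P? : Decidable P) (Q? : Decidable Q) →
  (∀ i → P i → Q i) → (∀ i → Q i → P i) → leastIndex P? ≡ leastIndex Q?
leastIndex-cong {zero} P? Q? f g = refl
leastIndex-cong {suc k} P? Q? f g with P? zero | Q? zero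
... | yes _ | yes _ = refl
... | yes p | no ¬q = contradiction (f zero p) ¬q
... | no ¬p | yes q = contradiction (g zero q) ¬p
... | no _  | no _  =
  cong suc (leastIndex-cong (λ i → P? (suc i)) (λ i → Q? (suc i)) (λ i → f (suc i)) (λ i → g (suc i)))

leastIndex-sat : ∀ {k} {P : Fin k → Set} (P? : Decidable P) → ∀ {j} → P j →
  ∃ λ i → P i × toℕ i ≡ leastIndex P?
leastIndex-sat {suc k} P? {j} pj with P? zero
... | yes p = zero , p , refl
leastIndex-sat {suc k} P? {zero} pj | no ¬p = contradiction pj ¬p
leastIndex-sat {suc k} P? {suc j} pj | no ¬p =
  let i , pi , eq = leastIndex-sat (λ i → P? (suc i)) pj in suc i , pi , cong suc eq

Least : (ℕ → Set) → ℕ → Set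
Least P k = P k × (∀ j → P j → k ≤ j)

least : ∀ {P : ℕ → Set} → Decidable P → ∀ {k} → P k → ∃ (Least P)
least {P} P? {k} pk = go k 0 (+-identityʳ k) (λ _ ())
  where
  -- `f` is fuel: by `f + j ≡ k` it runs out exactly when `j` is the known witness.
  go : ∀ f j → f + j ≡ k → (∀ i → i < j → ¬ P i) → ∃ (Least P)
  go f j eq low with P? j
  ... | yes pj = j , pj , λ i pi → ≮⇒≥ λ i<j → low i i<j pi
  go zero j refl low | no ¬pj = contradiction pk ¬pj
  go (suc f) j eq low | no ¬pj =
    go f (suc j) (trans (+-suc f j) eq) λ i i<1+j pi →
      [ (λ i<j → low i i<j pi) , (λ { refl → ¬pj pi }) ]′ (m≤n⇒m<n∨m≡n (≤-pred i<1+j))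

argmin : ∀ {k} {P : Fin k → Set} → Decidable P → (f : Fin k → ℕ) → ∃ P →
  ∃ λ i → P i × (∀ j → P j → f i ≤ f j)
argmin {P = P} P? f (i , pi)
  with least (λ v → any? λ j → P? j ×-dec (f j ≟ v)) (i , pi , refl)
... | v , (j , pj , refl) , low = j , pj , λ j′ pj′ → low (f j′) (j′ , pj′ , refl)

-- Colourings, connectivity, and large pieces of a large set.

module Colouring (G : Graph) where

  V : Set
  V = Fin (n G)

  infix 4 _~_ _~?_
  _~_ : V → V → Set
  _~_ = Adj G

  _~?_ : ∀ u w → Dec (u ~ w)
  _~?_ = adj? G

  ~-sym : ∀ {u w} → u ~ w → w ~ u
  ~-sym = Graph.sym G

  ~⇒≢ : ∀ {u w} → u ~ w → u ≢ w
  ~⇒≢ e refl = irrefl G e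

  -- Only the values on A are bounded, so Col A 0 says that A is empty.
  Col : (V → Set) → ℕ → Set
  Col A c = Σ (V → ℕ) λ f →
    (∀ u → A u → f u < c) × (∀ u w → A u → A w → u ~ w → f u ≢ f w)

  -- Largeness is the negative statement `¬ Col A c`. Deciding `Col` by enumeration is what lets a
  -- large piece be extracted from it.
  col? : ∀ {A} → Decidable A → ∀ c → Dec (Col A c)
  col? {A} A? c = map′ to from (anyVec? (n G) good?)
    where
    -- One colour more than `c`, since vertices outside `A` need a value even when `c` is 0. On `A`
    -- the truncation at `c` in `xs` changes nothing.
    Good : Vec (Fin (suc c)) (n G) → Set
    Good xs = (∀ u → A u → toℕ (Vec.lookup xs u) < c)
            × (∀ u w → A u → A w → u ~ w → toℕ (Vec.lookup xs u) ≢ toℕ (Vec.lookup xs w))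
    good? : Decidable Good
    good? xs = all? (λ u → A? u →-dec (_ <? _))
         ×-dec all? (λ u → all? λ w → A? u →-dec A? w →-dec u ~? w →-dec ¬? (_ ≟ _))
    to : ∃ Good → Col A c
    to (xs , b , p) = (λ u → toℕ (Vec.lookup xs u)) , b , p
    from : Col A c → ∃ Good
    from (f , b , p) = xs , (λ u au → subst (_< c) (sym (val u au)) (b u au))
                     , λ u w au aw e eq → p u w au aw e (trans (sym (val u au)) (trans eq (val w aw)))
      where
      xs : Vec (Fin (suc c)) (n G)
      xs = Vec.tabulate λ u → fromℕ< (s≤s (m⊓n≤n (f u) c))
      val : ∀ u → A u → toℕ (Vec.lookup xs u) ≡ f u
      val u au = trans (cong toℕ (lookup∘tabulate _ u))
        (trans (toℕ-fromℕ< _) (m≤n⇒m⊓n≡m (<⇒≤ (b u au))))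

  col-mono : ∀ {A B : V → Set} {c d} → (∀ u → A u → B u) → c ≤ d → Col B c → Col A d
  col-mono A⊆B c≤d (f , b , p) =
    f , (λ u au → ≤-trans (b u (A⊆B u au)) c≤d) , λ u w au aw → p u w (A⊆B u au) (A⊆B w aw)

  col-split : ∀ {A B : V → Set} {s t} → Decidable B →
    Col (λ u → A u × B u) s → Col (λ u → A u × ¬ B u) t → Col A (s + t)
  col-split {A} {B} {s} {t} B? (f , fb , fp) (g , gb , gp) = h , hb , hp
    where
    h : V → ℕ
    h u with B? u
    ... | yes _ = f u
    ... | no  _ = s + g u
    hb : ∀ u → A u → h u < s + t
    hb u au with B? u
    ... | yes bu = ≤-trans (fb u (au , bu)) (m≤m+n s t)
    ... | no ¬bu = +-monoʳ-< s (gb u (au , ¬bu))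
    hp : ∀ u w → A u → A w → u ~ w → h u ≢ h w
    hp u w au aw e eq with B? u | B? w
    ... | yes bu | yes bw = fp u w (au , bu) (aw , bw) e eq
    ... | yes bu | no ¬bw = <⇒≢ (≤-trans (fb u (au , bu)) (m≤m+n s (g w))) eq
    ... | no ¬bu | yes bw = <⇒≢ (≤-trans (fb w (aw , bw)) (m≤m+n s (g u))) (sym eq)
    ... | no ¬bu | no ¬bw = gp u w (au , ¬bu) (aw , ¬bw) e (+-cancelˡ-≡ s _ _ eq)

  remove : ∀ {A B : V → Set} {s t} → Decidable B →
    Col (λ u → A u × B u) s → ¬ Col A (s + t) → ¬ Col (λ u → A u × ¬ B u) t
  remove B? cb ¬ca ct = ¬ca (col-split B? cb ct)

  nonempty : ∀ {A : V → Set} {c} → Decidable A → ¬ Col A c → ∃ A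
  nonempty {A} A? ¬c with any? A?
  ... | yes a = a
  ... | no ¬a = contradiction
    ((λ _ → 0) , (λ u au → ⊥-elim (¬a (u , au))) , λ u _ au → ⊥-elim (¬a (u , au))) ¬c

  -- No edge joins two classes of `κ`, so if every class had `c` colours, all classes could share
  -- the same palette. Hence passing to a class is free.
  bigClass : ∀ {A : V → Set} {c} → Decidable A → (κ : V → ℕ) →
    (∀ u w → A u → A w → u ~ w → κ u ≡ κ w) → ¬ Col A c →
    ∃ λ a → A a × ¬ Col (λ u → A u × κ u ≡ κ a) c
  bigClass {A} {c} A? κ same ¬c
    with any? (λ a → A? a ×-dec ¬? (col? (λ u → A? u ×-dec (κ u ≟ κ a)) c))
  ... | yes (a , aa , ¬col) = a , aa , ¬col
  ... | no none = contradiction ((λ u → g (κ u) u) , bound , proper) ¬c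
    where
    small : ∀ a → A a → Col (λ u → A u × κ u ≡ κ a) c
    small a aa = decidable-stable (col? (λ u → A? u ×-dec (κ u ≟ κ a)) c) λ ¬s → none (a , aa , ¬s)
    -- The colouring is chosen from the value `i`, not from the vertex, so all members of a class
    -- use the same one whichever representative the search returns.
    g : ℕ → V → ℕ
    g i u with any? (λ a → A? a ×-dec (κ a ≟ i))
    ... | yes (a , aa , _) = proj₁ (small a aa) u
    ... | no _ = 0
    gb : ∀ i u → A u → κ u ≡ i → g i u < c
    gb i u au eq with any? (λ a → A? a ×-dec (κ a ≟ i))
    ... | yes (a , aa , eq′) = proj₁ (proj₂ (small a aa)) u (au , trans eq (sym eq′))
    ... | no ¬a = contradiction (u , au , eq) ¬a
    gp : ∀ i u w → A u → A w → κ u ≡ i → κ w ≡ i → u ~ w → g i u ≢ g i w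
    gp i u w au aw eu ew e eq with any? (λ a → A? a ×-dec (κ a ≟ i))
    ... | yes (a , aa , eq′) = proj₂ (proj₂ (small a aa)) u w
          (au , trans eu (sym eq′)) (aw , trans ew (sym eq′)) e eq
    ... | no ¬a = contradiction (u , au , eu) ¬a
    bound : ∀ u → A u → g (κ u) u < c
    bound u au = gb (κ u) u au refl
    proper : ∀ u w → A u → A w → u ~ w → g (κ u) u ≢ g (κ w) w
    proper u w au aw e eq = gp (κ u) u w au aw refl (sym κ≡) e (trans eq (cong (λ i → g i w) (sym κ≡)))
      where κ≡ = same u w au aw e

  -- The start is exempt from lying in `A`: later, `D` is entered from a vertex `v` outside `D`.
  data Reach (A : V → Set) (a : V) : V → Set where
    here : Reach A a a
    step : ∀ {u w} → Reach A a u → A w → u ~ w → Reach A a w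

  reach-mono : ∀ {A B : V → Set} {a w} → (∀ {u} → A u → B u) → Reach A a w → Reach B a w
  reach-mono f here = here
  reach-mono f (step r aw e) = step (reach-mono f r) (f aw) e

  reach-trans : ∀ {A : V → Set} {a u w} → Reach A a u → Reach A u w → Reach A a w
  reach-trans r here = r
  reach-trans r (step s aw e) = step (reach-trans r s) aw e

  reach-sym : ∀ {A : V → Set} {a w} → A a → Reach A a w → Reach A w a
  reach-sym aa here = here
  reach-sym aa r@(step {u} r′ aw e) = reach-trans (step here (au r′) (~-sym e)) (reach-sym aa r′)
    where
    au : ∀ {u} → Reach _ _ u → _
    au here = aa
    au (step _ p _) = p

  reach-in : ∀ {A : V → Set} {a w} → A a → Reach A a w → A w
  reach-in aa here = aa
  reach-in aa (step _ aw _) = aw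

  -- Every vertex passed on the way is itself reached, so a component is connected inside itself.
  reach-self : ∀ {A : V → Set} {a w} → Reach A a w → Reach (Reach A a) a w
  reach-self here = here
  reach-self r@(step r′ aw e) = step (reach-self r′) r e

  -- A set of reached vertices around `a` grows one vertex at a time. Once no vertex of `A` outside
  -- it has a neighbour in it, it is everything reachable. The number of vertices outside decreases.
  reach? : ∀ {A : V → Set} → Decidable A → ∀ a → Decidable (Reach A a)
  reach? {A} A? a w = saturate ⁅ a ⁆ (<-wellFounded _)
      (λ u u∈ → subst (Reach A a) (sym (x∈⁅y⁆⇒x≡y a u∈)) here) (x∈⁅x⁆ a) w
    where
    saturate : (B : Subset (n G)) → Acc _<_ (n G ∸ ∣ B ∣) →
      (∀ u → u ∈ B → Reach A a u) → a ∈ B → ∀ w → Dec (Reach A a w)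
    saturate B (acc rs) sound a∈B w
      with any? (λ x → ¬? (x ∈? B) ×-dec A? x ×-dec any? (λ u → (u ∈? B) ×-dec (u ~? x)))
    ... | yes (x , x∉B , ax , u , u∈B , e) =
      saturate (B ∪ ⁅ x ⁆) (rs (∸-monoʳ-< (p⊂q⇒∣p∣<∣q∣ B⊂) (∣p∣≤n (B ∪ ⁅ x ⁆)))) sound′
        (x∈p∪q⁺ (inj₁ a∈B)) w
      where
      B⊂ : B ⊂ (B ∪ ⁅ x ⁆)
      B⊂ = (λ y∈B → x∈p∪q⁺ (inj₁ y∈B)) , x , x∈p∪q⁺ (inj₂ (x∈⁅x⁆ x)) , x∉B
      sound′ : ∀ y → y ∈ B ∪ ⁅ x ⁆ → Reach A a y
      sound′ y y∈ with x∈p∪q⁻ B ⁅ x ⁆ y∈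
      ... | inj₁ y∈B = sound y y∈B
      ... | inj₂ y∈x with refl ← x∈⁅y⁆⇒x≡y x y∈x = step (sound u u∈B) ax e
    ... | no closed = map′ (sound w) complete (w ∈? B)
      where
      complete : ∀ {w} → Reach A a w → w ∈ B
      complete here = a∈B
      complete (step {u} {w} r aw e) with w ∈? B
      ... | yes w∈B = w∈B
      ... | no w∉B = contradiction (w , w∉B , aw , u , complete r , e) closed

  -- `κ` names a vertex by the least root in `A` that reaches it. Neighbours have the same roots, so
  -- `bigClass` applies, and equal names put a whole class into the component of one root.
  bigComponent : ∀ {A : V → Set} {c} → Decidable A → ¬ Col A c →
    ∃ λ a → A a × ¬ Col (Reach A a) c
  bigComponent {A} {c} A? ¬c = finish (bigClass A? κ same ¬c)
    where
    Root : V → V → Set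
    Root u b = A b × Reach A b u
    root? : ∀ u → Decidable (Root u)
    root? u b = A? b ×-dec reach? A? b u
    κ : V → ℕ
    κ u = leastIndex (root? u)
    same : ∀ u w → A u → A w → u ~ w → κ u ≡ κ w
    same u w au aw e = leastIndex-cong (root? u) (root? w)
      (λ b (ab , r) → ab , step r aw e) (λ b (ab , r) → ab , step r au (~-sym e))
    root : ∀ u → A u → ∃ λ b → Root u b × toℕ b ≡ κ u
    root u au = leastIndex-sat (root? u) (au , here)
    finish : (∃ λ a → A a × ¬ Col (λ u → A u × κ u ≡ κ a) c) → ∃ λ a → A a × ¬ Col (Reach A a) c
    finish (a , aa , ¬cola) with root a aa
    ... | b , (ab , _) , eqb = b , ab , λ cb → ¬cola (col-mono sub ≤-refl cb)
      where
      sub : ∀ u → A u × κ u ≡ κ a → Reach A b u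
      sub u (au , eq) with root u au
      ... | b′ , (_ , r) , eq′ =
        subst (λ x → Reach A x u) (toℕ-injective (trans eq′ (trans eq (sym eqb)))) r

-- Parity arithmetic.

even⇒odd : ∀ {k} → Even k → Odd (suc k)
even⇒odd (i , refl) = i , refl

odd⇒even : ∀ {k} → Odd k → Even (suc k)
odd⇒even (i , refl) = suc i , cong suc (sym (+-suc i (i + 0)))

even⊎odd : ∀ k → Even k ⊎ Odd k
even⊎odd zero = inj₁ (0 , refl)
even⊎odd (suc k) = swap ([ (λ e → inj₁ (even⇒odd e)) , (λ o → inj₂ (odd⇒even o)) ]′ (even⊎odd k))

even-pred : ∀ {k} → Even (suc k) → Odd k
odd-pred : ∀ {k} → Odd (suc k) → Even k
even-pred (suc i , eq) = i , trans (suc-injective eq) (+-suc i (i + 0))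
odd-pred (i , eq) = i , suc-injective eq

¬even×odd : ∀ {k} → Even k → ¬ Odd k
¬even×odd {zero} _ (_ , ())
¬even×odd {suc k} e o = ¬even×odd (odd-pred o) (even-pred e)

even? : Decidable Even
even? k = [ yes , (λ o → no λ e → ¬even×odd e o) ]′ (even⊎odd k)

¬even⇒odd : ∀ {k} → ¬ Even k → Odd k
¬even⇒odd {k} ¬e = [ (λ e → contradiction e ¬e) , (λ o → o) ]′ (even⊎odd k)

even+even : ∀ {j k} → Even j → Even k → Even (j + k)
even+even (a , refl) (b , refl) = a + b , sym (*-distribˡ-+ 2 a b)

even+odd : ∀ {j k} → Even j → Odd k → Odd (j + k)
even+odd {j} {suc k} e o = subst Odd (sym (+-suc j k)) (even⇒odd (even+even e (odd-pred o)))
even+odd {k = zero} e (_ , ())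

odd+even : ∀ {j k} → Odd j → Even k → Odd (j + k)
odd+even {j} {k} o e = subst Odd (+-comm k j) (even+odd e o)

odd+odd : ∀ {j k} → Odd j → Odd k → Even (j + k)
odd+odd {suc j} o o′ = odd⇒even (even+odd (odd-pred o) o′)
odd+odd {zero} (_ , ()) _

odd-split : ∀ j {k} → Odd (j + k) → Odd j ⊎ Odd k
odd-split j {k} o with even⊎odd j | even⊎odd k
... | inj₂ oj | _ = inj₁ oj
... | _ | inj₂ ok = inj₂ ok
... | inj₁ ej | inj₁ ek = contradiction o (¬even×odd (even+even ej ek))

-- Walks, short odd cycles, and balls of radius 4.

module Walks (G : Graph) where
  open Colouring G public

  Walk : ℕ → V → V → Set
  Walk zero a b = a ≡ b
  Walk (suc k) a b = ∃ λ c → a ~ c × Walk k c b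

  walk? : ∀ k a b → Dec (Walk k a b)
  walk? zero a b = a ≟ᶠ b
  walk? (suc k) a b = any? λ c → a ~? c ×-dec walk? k c b

  _++ʷ_ : ∀ {j k a b c} → Walk j a b → Walk k b c → Walk (j + k) a c
  _++ʷ_ {zero} refl w = w
  _++ʷ_ {suc j} (d , e , v) w = d , e , v ++ʷ w

  edge : ∀ {a b} → a ~ b → Walk 1 a b
  edge e = _ , e , refl

  revʷ : ∀ {k a b} → Walk k a b → Walk k b a
  revʷ {zero} refl = refl
  revʷ {suc k} {a} {b} (c , e , w) = subst (λ j → Walk j b a) (+-comm k 1) (revʷ w ++ʷ edge (~-sym e))

  -- An index past the end returns the last vertex, which keeps the function total.
  at : ∀ {k a b} → Walk k a b → ℕ → V
  at {zero} {a} _ _ = a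
  at {suc k} {a} _ zero = a
  at {suc k} (_ , _ , w) (suc i) = at w i

  at-zero : ∀ {k a b} (w : Walk k a b) → at w 0 ≡ a
  at-zero {zero} _ = refl
  at-zero {suc k} _ = refl

  at-end : ∀ {k a b} (w : Walk k a b) → at w k ≡ b
  at-end {zero} refl = refl
  at-end {suc k} (_ , _ , w) = at-end w

  at-step : ∀ {k a b} (w : Walk k a b) {i} → i < k → at w i ~ at w (suc i)
  at-step {suc k} (c , e , w) {zero} _ = subst (_ ~_) (sym (at-zero w)) e
  at-step {suc k} (c , e , w) {suc i} (s≤s i<k) = at-step w i<k

  takeʷ : ∀ i {k a b} (w : Walk (i + k) a b) → Walk i a (at w i)
  takeʷ zero w = sym (at-zero w)
  takeʷ (suc i) (c , e , w) = c , e , takeʷ i w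

  dropʷ : ∀ i {k a b} (w : Walk (i + k) a b) → Walk k (at w i) b
  dropʷ zero {k} {b = b} w = subst (λ x → Walk k x b) (sym (at-zero w)) w
  dropʷ (suc i) (c , e , w) = dropʷ i w

  at-+ : ∀ i d {k a b} (w : Walk (i + (d + k)) a b) → at w (i + d) ≡ at (dropʷ i w) d
  at-+ zero d {k} {a} {b} w = lem (sym (at-zero w)) w
    where
    lem : ∀ {a′} (eq : a ≡ a′) (w : Walk (d + k) a b) → at w d ≡ at (subst (λ x → Walk (d + k) x b) eq w) d
    lem refl w = refl
  at-+ (suc i) d (c , e , w) = at-+ i d w

  -- A repeated vertex cuts a closed odd walk into two shorter closed walks, one of which is odd.
  -- Without repetition among the positions below `k` the walk is a cycle; position `k` is left out
  -- because it always repeats the start.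
  oddCycle : ∀ {k a} → Acc _<_ k → Odd k → Walk k a a →
    ∃ λ m → Σ (Fin (suc m) → V) λ c → IsCycle G m c × Odd (suc m) × suc m ≤ k
  oddCycle {k} {a} (acc rs) odd w
    with any? {n = k} (λ i → any? {n = k} λ j → (toℕ i <? toℕ j) ×-dec (at w (toℕ i) ≟ᶠ at w (toℕ j)))
  ... | yes (i , j , i<j , eq) = shorten (toℕ i) (toℕ j ∸ toℕ i) (k ∸ toℕ j) (m<n⇒0<n∸m i<j)
        (m<n⇒0<n∸m (toℕ<n j)) k≡ w (trans eq (cong (at w) (sym (m+[n∸m]≡n (<⇒≤ i<j)))))
    where
    k≡ : k ≡ toℕ i + ((toℕ j ∸ toℕ i) + (k ∸ toℕ j))
    k≡ = sym (trans (sym (+-assoc (toℕ i) _ _))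
      (trans (cong (_+ (k ∸ toℕ j)) (m+[n∸m]≡n (<⇒≤ i<j))) (m+[n∸m]≡n (<⇒≤ (toℕ<n j)))))
    shorten : ∀ i d r → 0 < d → 0 < r → k ≡ i + (d + r) → (w : Walk k a a) → at w i ≡ at w (i + d) →
      ∃ λ m → Σ (Fin (suc m) → V) λ c → IsCycle G m c × Odd (suc m) × suc m ≤ k
    shorten i d r 0<d 0<r refl w eq = [ viaInner , viaOuter ]′ (odd-split d (subst Odd arr odd))
      where
      arr : i + (d + r) ≡ d + (i + r)
      arr = trans (sym (+-assoc i d r)) (trans (cong (_+ r) (+-comm i d)) (+-assoc d i r))
      loop : at (dropʷ i w) d ≡ at w i
      loop = sym (trans eq (at-+ i d w))
      d<k : d < i + (d + r)
      d<k = subst (d <_) (sym arr) (m<m+n d (≤-trans 0<r (m≤n+m r i)))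
      o<k : i + r < i + (d + r)
      o<k = +-monoʳ-< i (m<n+m r 0<d)
      Result = ∃ λ m → Σ (Fin (suc m) → V) λ c → IsCycle G m c × Odd (suc m) × suc m ≤ i + (d + r)
      viaInner : Odd d → Result
      viaInner o with oddCycle (rs d<k) o (subst (Walk d (at w i)) loop (takeʷ d (dropʷ i w)))
      ... | m , c , cyc , om , le = m , c , cyc , om , ≤-trans le (<⇒≤ d<k)
      viaOuter : Odd (i + r) → Result
      viaOuter o with oddCycle (rs o<k) o
        (takeʷ i w ++ʷ subst (λ x → Walk r x a) loop (dropʷ d (dropʷ i w)))
      ... | m , c , cyc , om , le = m , c , cyc , om , ≤-trans le (<⇒≤ o<k)
  oddCycle {zero} (acc rs) (_ , ()) w | no simple
  oddCycle {suc zero} {a} (acc rs) odd (c , e , refl) | no simple = contradiction e (irrefl G)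
  oddCycle {suc (suc zero)} (acc rs) odd w | no simple =
    contradiction odd (¬even×odd (1 , refl))
  oddCycle {suc m@(suc (suc _))} {a} (acc rs) odd w | no simple =
    m , c , record { long = s≤s (s≤s z≤n) ; distinct = inj ; steps = steps } , odd , ≤-refl
    where
    c : Fin (suc m) → V
    c i = at w (toℕ i)
    inj : ∀ {i j} → c i ≡ c j → i ≡ j
    inj {i} {j} eq with <-cmp (toℕ i) (toℕ j)
    ... | tri< lt _ _ = contradiction (i , j , lt , eq) simple
    ... | tri≈ _ e _ = toℕ-injective e
    ... | tri> _ _ gt = contradiction (j , i , gt , sym eq) simple
    steps : ∀ i → c i ~ c (cnext i)
    steps i with suc (toℕ i) <? suc m
    ... | yes lt = subst (λ x → c i ~ at w x) (sym (trans (toℕ-fromℕ< _) (m<n⇒m%n≡m lt))) (at-step w (toℕ<n i))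
    ... | no ¬lt = subst (c i ~_) wrap (at-step w (toℕ<n i))
      where
      last : suc (toℕ i) ≡ suc m
      last = ≤-antisym (toℕ<n i) (≮⇒≥ ¬lt)
      wrap : at w (suc (toℕ i)) ≡ c (cnext i)
      wrap = trans (cong (at w) last) (trans (at-end w) (trans (sym (at-zero w))
        (cong (at w) (sym (trans (toℕ-fromℕ< (m%n<n (suc (toℕ i)) (suc m)))
          (subst (λ x → x % suc m ≡ 0) (sym last) (n%n≡0 (suc m))))))))

  Near : V → V → Set
  Near a w = ∃ λ (k : Fin 5) → Walk (toℕ k) a w

  near? : ∀ a → Decidable (Near a)
  near? a w = any? λ k → walk? (toℕ k) a w

  near : ∀ {a w} k → k ≤ 4 → Walk k a w → Near a w
  near {a} {w} k k≤4 p = fromℕ< (s≤s k≤4) , subst (λ j → Walk j a w) (sym (toℕ-fromℕ< (s≤s k≤4))) p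

  module Locality (og : OddGirth≥ G 11) where

    noOddWalk : ∀ {k a} → k < 11 → Odd k → ¬ Walk k a a
    noOddWalk {k} k<11 odd w with oddCycle (<-wellFounded k) odd w
    ... | m , c , cyc , om , le = <⇒≱ k<11 (≤-trans (og m c cyc om) le)

    noTriangle : ∀ {a b c} → a ~ b → b ~ c → ¬ c ~ a
    noTriangle {a} ab bc ca = noOddWalk {3} {a} (m≤m+n 4 7) (1 , refl) (_ , ab , _ , bc , _ , ca , refl)

    noPentagon : ∀ {a b c d e} → a ~ b → b ~ c → c ~ d → d ~ e → ¬ e ~ a
    noPentagon {a} ab bc cd de ea =
      noOddWalk {5} {a} (m≤m+n 6 5) (2 , refl) (_ , ab , _ , bc , _ , cd , _ , de , _ , ea , refl)

    -- Colour by whether an even walk of length at most 4 arrives. An edge with equal colours at its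
    -- ends joins two walks of equal parity into a closed odd walk of length at most 9.
    near-col : ∀ a → Col (Near a) 2
    near-col a = f , bound , proper
      where
      EvenNear : V → Set
      EvenNear w = ∃ λ (k : Fin 5) → Even (toℕ k) × Walk (toℕ k) a w
      evenNear? : Decidable EvenNear
      evenNear? w = any? λ k → even? (toℕ k) ×-dec walk? (toℕ k) a w
      f : V → ℕ
      f w with evenNear? w
      ... | yes _ = 0
      ... | no _ = 1
      bound : ∀ u → Near a u → f u < 2
      bound u _ with evenNear? u
      ... | yes _ = s≤s z≤n
      ... | no _ = s≤s (s≤s z≤n)
      closed : ∀ {u w} (j k : Fin 5) → Even (toℕ j + toℕ k) → Walk (toℕ j) a u → Walk (toℕ k) a w → ¬ u ~ w
      closed j k e p q uw = noOddWalk {toℕ j + suc (toℕ k)} {a}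
        (s≤s (subst (_≤ 10) (sym (+-suc (toℕ j) (toℕ k))) (≤-trans (s≤s (+-mono-≤ (≤-pred (toℕ<n j)) (≤-pred (toℕ<n k)))) (n≤1+n 9))))
        (subst Odd (sym (+-suc (toℕ j) (toℕ k))) (even⇒odd e))
        (p ++ʷ (_ , uw , revʷ q))
      proper : ∀ u w → Near a u → Near a w → u ~ w → f u ≢ f w
      proper u w (j , p) (k , q) uw eq with evenNear? u | evenNear? w
      ... | yes (j′ , ej , p′) | yes (k′ , ek , q′) = closed j′ k′ (even+even ej ek) p′ q′ uw
      ... | no ¬u | no ¬w = closed j k
            (odd+odd (¬even⇒odd λ e → ¬u (j , e , p)) (¬even⇒odd λ e → ¬w (k , e , q))) p q uw
      proper u w _ _ uw () | yes _ | no _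
      proper u w _ _ uw () | no _ | yes _

-- Induced paths as lists.

data Edges {A : Set} : List A → A → A → Set where
  here  : ∀ {a b l} → Edges (a ∷ b ∷ l) a b
  there : ∀ {a l u w} → Edges l u w → Edges (a ∷ l) u w

data EndsAt {A : Set} : List A → A → Set where
  end  : ∀ {e} → EndsAt (e ∷ []) e
  more : ∀ {a l e} → EndsAt l e → EndsAt (a ∷ l) e

module Paths (G : Graph) where
  open Walks G public

  Apart : V → V → Set
  Apart a b = a ≢ b × ¬ a ~ b

  data Induced : List V → Set where
    sing : ∀ {a} → Induced (a ∷ [])
    cons : ∀ {a b l} → a ~ b → All (Apart a) l → Induced (b ∷ l) → Induced (a ∷ b ∷ l)

  consHead : ∀ {z w l r} → l ≡ w ∷ r → z ~ w → (∀ {y} → y ∈ˡ r → Apart z y) → Induced l → Induced (z ∷ l)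
  consHead refl e f p = cons e (All.tabulate f) p

  glue : ∀ l {v r} → Induced (l ++ v ∷ []) → Induced (v ∷ r) →
    (∀ {y a} → y ∈ˡ l → a ∈ˡ r → Apart y a) → Induced (l ++ v ∷ r)
  glue [] _ q _ = q
  glue (y ∷ []) (cons e _ _) q f = cons e (All.tabulate (f (here refl))) q
  glue (y ∷ y′ ∷ l) (cons e ap p) q f with All.++⁻ l ap
  ... | ap₁ , ap₂ ∷ [] =
    cons e (All.++⁺ ap₁ (ap₂ ∷ All.tabulate (f (here refl)))) (glue (y′ ∷ l) p q (λ i → f (there i)))

  induced-unique : ∀ {l} → Induced l → Unique l
  induced-unique sing = [] ∷ []
  induced-unique (cons e ap p) = (~⇒≢ e ∷ All.map proj₁ ap) ∷ induced-unique p

  induced-edge : ∀ {l u w} → Induced l → Edges l u w → u ~ w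
  induced-edge (cons e _ _) here = e
  induced-edge (cons _ _ p) (there i) = induced-edge p i

  induced-adj : ∀ {l u w} → Induced l → u ∈ˡ l → w ∈ˡ l → u ~ w → Edges l u w ⊎ Edges l w u
  induced-adj p (here refl) (here refl) e = contradiction e (irrefl G)
  induced-adj (cons _ _ _) (here refl) (there (here refl)) e = inj₁ here
  induced-adj (cons _ ap _) (here refl) (there (there j)) e = contradiction e (proj₂ (All.lookup ap j))
  induced-adj (cons _ _ _) (there (here refl)) (here refl) e = inj₂ here
  induced-adj (cons _ ap _) (there (there i)) (here refl) e = contradiction (~-sym e) (proj₂ (All.lookup ap i))
  induced-adj (cons _ _ p) (there i) (there j) e =
    [ (λ x → inj₁ (there x)) , (λ x → inj₂ (there x)) ]′ (induced-adj p i j e)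

  -- `a` is attached to the last vertex of the path that it equals or sees. All vertices after that
  -- one are apart from it, so no chord arises.
  shortcut : ∀ {a b l e} → Induced (b ∷ l) → EndsAt (b ∷ l) e → Any (λ c → a ≡ c ⊎ a ~ c) (b ∷ l) →
    ∃ λ l′ → Induced (a ∷ l′) × EndsAt (a ∷ l′) e × (∀ {y} → y ∈ˡ l′ → y ∈ˡ b ∷ l)
  shortcut {a} {b} {l} p en touch with Any.any? (λ c → (a ≟ᶠ c) ⊎-dec (a ~? c)) l
  shortcut {l = l} p en (there touch) | no ¬t = contradiction touch ¬t
  shortcut {l = l} p en (here (inj₁ refl)) | no ¬t = l , p , en , there
  shortcut {l = l} p en (here (inj₂ e)) | no ¬t =
    _ , cons e (All.map (λ ¬x → (λ eq → ¬x (inj₁ eq)) , (λ ad → ¬x (inj₂ ad))) (All.¬Any⇒All¬ l ¬t)) p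
      , more en , λ i → i
  shortcut {l = _ ∷ _} (cons _ _ p) (more en) _ | yes t with shortcut p en t
  ... | l′ , p′ , en′ , f = l′ , p′ , en′ , λ i → there (f i)

  reach⇒induced : ∀ {A : V → Set} {a w} → Reach A a w →
    ∃ λ l → Induced (w ∷ l) × EndsAt (w ∷ l) a × (∀ {y} → y ∈ˡ l → A y ⊎ y ≡ a)
  reach⇒induced here = [] , sing , end , λ ()
  reach⇒induced {A} {a} (step {u} {w} r aw e) with reach⇒induced r
  ... | l , p , en , f with shortcut p en (here (inj₂ (~-sym e)))
  ...   | l′ , p′ , en′ , g = l′ , p′ , en′ , λ i → inA r (g i)
    where
    inA : ∀ {y} → Reach A a u → y ∈ˡ u ∷ l → A y ⊎ y ≡ a
    inA here (here refl) = inj₂ refl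
    inA (step _ au _) (here refl) = inj₁ au
    inA _ (there i) = f i

  -- Breadth-first levels.

  module Levels {D : V → Set} (D? : Decidable D) (v : V) (¬Dv : ¬ D v)
    (reach : ∀ {d} → D d → Reach D v d) where

    D⁺ : V → Set
    D⁺ w = w ≡ v ⊎ D w

    D⁺? : Decidable D⁺
    D⁺? w = (w ≟ᶠ v) ⊎-dec D? w

    private
      At : ℕ → V → Set
      At zero w = w ≡ v
      At (suc k) w = D w × ∃ λ u → At k u × u ~ w

      at? : ∀ k → Decidable (At k)
      at? zero w = w ≟ᶠ v
      at? (suc k) w = D? w ×-dec any? λ u → at? k u ×-dec (u ~? w)

      at-exists : ∀ {w} → Reach D v w → ∃ λ k → At k w
      at-exists here = 0 , refl
      at-exists (step r dw e) with at-exists r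
      ... | k , a = suc k , dw , _ , a , e

      at⇒D⁺ : ∀ k {w} → At k w → D⁺ w
      at⇒D⁺ zero eq = inj₁ eq
      at⇒D⁺ (suc k) (dw , _) = inj₂ dw

    level : V → ℕ
    level w with D? w
    ... | yes dw = proj₁ (least (λ k → at? k w) (proj₂ (at-exists (reach dw))))
    -- The default is the correct value at `v`, which lies outside `D`; the properties of levels are
    -- stated on `D⁺` only.
    ... | no _ = 0

    level-v : level v ≡ 0
    level-v with D? v
    ... | yes dv = contradiction dv ¬Dv
    ... | no _ = refl

    private
      level-least : ∀ {w} → D⁺ w → Least (λ k → At k w) (level w)
      level-least (inj₁ refl) = subst (λ k → Least (λ k → At k v) k) (sym level-v) (refl , λ _ _ → z≤n)
      level-least {w} (inj₂ dw) with D? w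
      ... | yes dw′ = proj₂ (least (λ k → at? k w) (proj₂ (at-exists (reach dw′))))
      ... | no ¬dw = contradiction dw ¬dw

    level-≤ : ∀ {u w} → D⁺ u → D w → u ~ w → level w ≤ suc (level u)
    level-≤ {u} du dw e = proj₂ (level-least (inj₂ dw)) _ (dw , u , proj₁ (level-least du) , e)

    parent : ∀ {w} → D w → ∃ λ u → D⁺ u × u ~ w × level w ≡ suc (level u)
    parent {w} dw = lem (level w) refl (proj₁ (level-least (inj₂ dw)))
      where
      lem : ∀ k → level w ≡ k → At k w → ∃ λ u → D⁺ u × u ~ w × level w ≡ suc (level u)
      lem zero _ refl = contradiction dw ¬Dv
      lem (suc k) eq (_ , u , a , e) = u , du , e , ≤-antisym (level-≤ du dw e)
        (subst (suc (level u) ≤_) (sym eq) (s≤s (proj₂ (level-least du) k a)))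
        where du = at⇒D⁺ k a

    level>0 : ∀ {w} → D w → 0 < level w
    level>0 dw with parent dw
    ... | _ , _ , _ , eq = subst (0 <_) (sym eq) (s≤s z≤n)

    level0⇒v : ∀ {w} → D⁺ w → level w ≡ 0 → w ≡ v
    level0⇒v (inj₁ eq) _ = eq
    level0⇒v (inj₂ dw) eq = contradiction (sym eq) (<⇒≢ (level>0 dw))

    level⇒walk : ∀ k {w} → D⁺ w → level w ≡ k → Walk k v w
    level⇒walk zero dw eq = sym (level0⇒v dw eq)
    level⇒walk (suc k) (inj₁ refl) eq = contradiction (trans (sym level-v) eq) λ ()
    level⇒walk (suc k) {w} (inj₂ dw) eq with parent dw
    ... | u , du , e , eq′ =
      subst (λ j → Walk j v w) (+-comm k 1)
        (level⇒walk k du (suc-injective (trans (sym eq′) eq)) ++ʷ edge e)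

    -- Following parents lowers the level by one each time, while an edge into `D` raises it by at
    -- most one, so there are no chords. The path is returned in two forms: without `v`, as routes
    -- are stored, and with its head `w` split off, where all further levels lie below `k`.
    geodesic : ∀ k {w} → D⁺ w → level w ≡ k →
      ∃ λ g → Induced (g ++ v ∷ []) × length g ≡ k
            × (∀ {y} → y ∈ˡ g → D y × (y ≡ w ⊎ level y < k))
            × ∃ λ r → g ++ v ∷ [] ≡ w ∷ r × (∀ {y} → y ∈ˡ r → D⁺ y × level y < k)
    geodesic zero dw eq with refl ← level0⇒v dw eq = [] , sing , refl , (λ ()) , [] , refl , λ ()
    geodesic (suc k) (inj₁ refl) eq = contradiction (trans (sym level-v) eq) λ ()
    geodesic (suc k) {w} (inj₂ dw) eq with parent dw
    ... | u , du , e , eq′ with geodesic k du (suc-injective (trans (sym eq′) eq))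
    ...   | g , p , len , low , r , g≡ , lowr =
      w ∷ g , consHead g≡ (~-sym e) apart p , cong suc len , low′ , g ++ v ∷ [] , refl , lowr′
      where
      level-u = suc-injective (trans (sym eq′) eq)
      apart : ∀ {y} → y ∈ˡ r → Apart w y
      apart {y} i with lowr i
      ... | dy , y<k =
        (λ { refl → <⇒≱ y<k (subst (k ≤_) (sym eq) (n≤1+n k)) })
        , λ ad → <⇒≱ y<k (≤-pred (subst (_≤ suc (level y)) eq (level-≤ dy dw (~-sym ad))))
      low′ : ∀ {y} → y ∈ˡ w ∷ g → D y × (y ≡ w ⊎ level y < suc k)
      low′ (here refl) = dw , inj₁ refl
      low′ (there i) with low i
      ... | dy , inj₁ refl = dy , inj₂ (s≤s (≤-reflexive level-u))
      ... | dy , inj₂ lt = dy , inj₂ (m≤n⇒m≤1+n lt)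
      lowr′ : ∀ {y} → y ∈ˡ g ++ v ∷ [] → D⁺ y × level y < suc k
      lowr′ i with subst (_ ∈ˡ_) g≡ i
      ... | here refl = du , s≤s (≤-reflexive level-u)
      ... | there j = proj₁ (lowr j) , m≤n⇒m≤1+n (proj₂ (lowr j))

-- One link: two routes of opposite parity.

SameParity OppositeParity : ℕ → ℕ → Set
SameParity j k = (Even j × Even k) ⊎ (Odd j × Odd k)
OppositeParity j k = (Odd j × Even k) ⊎ (Even j × Odd k)

opposite : ∀ {s t} → SameParity s t → ∀ i j → Odd (i + j) → OppositeParity (i + s) (j + t)
opposite p i j o with even⊎odd i | even⊎odd j
opposite (inj₁ (es , et)) i j o | inj₁ ei | inj₂ oj = inj₂ (even+even ei es , odd+even oj et)
opposite (inj₂ (os , ot)) i j o | inj₁ ei | inj₂ oj = inj₁ (even+odd ei os , odd+odd oj ot)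
opposite (inj₁ (es , et)) i j o | inj₂ oi | inj₁ ej = inj₁ (odd+even oi es , even+even ej et)
opposite (inj₂ (os , ot)) i j o | inj₂ oi | inj₁ ej = inj₂ (odd+odd oi os , even+odd ej ot)
opposite _ i j o | inj₁ ei | inj₁ ej = contradiction o (¬even×odd (even+even ei ej))
opposite _ i j o | inj₂ oi | inj₂ oj = contradiction o (¬even×odd (odd+odd oi oj))

module LinkLemma (G : Graph) (og : OddGirth≥ G 11) where
  open Paths G public
  open Locality og public

  neighbours-col : ∀ {A : V → Set} z → Col (λ u → A u × z ~ u) 2
  neighbours-col z = col-mono (λ u (_ , e) → near 1 (s≤s z≤n) (edge e)) ≤-refl (near-col z)

  -- Used with `E` a component left after deleting neighbourhoods. The vertex at which a walk leaves
  -- `E` is adjacent to `E` without belonging to it, so it must be one of the deleted vertices,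
  -- which reveals a neighbour of it.
  exit : ∀ {A E : V → Set} {a w} → Decidable E → Reach A a w → E a → ¬ E w →
    ∃ λ e → ∃ λ u → E e × Reach A a u × A u × ¬ E u × e ~ u
  exit E? here ea ¬ew = contradiction ea ¬ew
  exit E? (step {u} {w} r aw e) ea ¬ew with E? u
  ... | yes eu = u , w , eu , step r aw e , aw , ¬ew , e
  ... | no ¬eu = exit E? r ea ¬eu

  module Step {D : V → Set} (D? : Decidable D) (v : V) (¬Dv : ¬ D v)
    (reach : ∀ {d} → D d → Reach D v d)
    {X : V → Set} (X? : Decidable X) (X∩D : ∀ {x} → X x → ¬ D x) (¬Xv : ¬ X v)
    where

    open Levels D? v ¬Dv reach public

    -- `Low` is what the next `D` and `X` must not touch, except at `b`: the tree strictly below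
    -- level `t` and the named vertices. It contains both routes. `apart` handles `E`, and `height`
    -- handles the tree part for vertices of `X` next to `E`. The named vertices other than `b` are
    -- `z`, `z′` and neighbours of these, so two balls will take care of them.
    record Link (A : V → Set) (c : ℕ) : Set₁ where
      field
        b τ τ′ z z′ u k : V
        t : ℕ
        E : V → Set
        E? : Decidable E
        E⊆A : ∀ {w} → E w → A w
        big : ¬ Col E c
        conn : ∀ {w} → E w → Reach E b w
        Ab : A b
        ¬Eb : ¬ E b
        route : Fin 2 → List V
        route-head : ∀ h → ∃ λ s → route h ≡ b ∷ s
        route-induced : ∀ h → Induced (route h ++ v ∷ [])
        route-odd : Odd (length (route zero))
        route-even : Even (length (route (suc zero)))

      Low : V → Set
      Low y = (D y × level y < t) ⊎ y ∈ˡ τ ∷ τ′ ∷ z ∷ z′ ∷ u ∷ k ∷ b ∷ []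

      field
        route-in : ∀ h {y} → y ∈ˡ route h → (D y ⊎ (X y × (y ≡ z ⊎ y ≡ z′))) × Low y
        apart : ∀ {w y} → E w → Low y → y ≢ b → Apart w y
        height : ∀ {w x y} → E w → X x → x ~ w → D⁺ y → x ~ y → t ≤ level y
        -- `v` is outside `D`, so the tree part of `Low` misses it. If a vertex of `X` next to `E`
        -- sees `v`, then `height` forces `t ≡ 0`, and `v` is the neighbour `τ` of `z`.
        τ-v : t ≡ 0 → τ ≡ v
        zτ : z ~ τ
        z′τ′ : z′ ~ τ′
        zu : z ~ u
        z′k : z′ ~ k

    module Target {l″ : ℕ} {A : V → Set} (A? : Decidable A)
      (A⊆D : ∀ {w} → A w → D w) (A-level : ∀ {w} → A w → level w ≡ 2 + l″) where

      Z : V → Set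
      Z z = X z ⊎ (D z × level z ≡ suc l″)

      Z? : Decidable Z
      Z? z = X? z ⊎-dec (D? z ×-dec (level z ≟ suc l″))

      -- η w is the lowest level of the breadth-first tree from v that w reaches through a single
      -- vertex of Z. It is at most l″, since the parent of w lies in Z; smaller values come from X.
      Touch : ℕ → V → Set
      Touch j w = ∃ λ τ → ∃ λ z → D⁺ τ × level τ ≡ j × Z z × z ~ τ × z ~ w

      touch? : ∀ j → Decidable (Touch j)
      touch? j w = any? λ τ → any? λ z →
        D⁺? τ ×-dec (level τ ≟ j) ×-dec Z? z ×-dec (z ~? τ) ×-dec (z ~? w)

      touch-exists : ∀ {w} → A w → Touch l″ w
      touch-exists {w} aw with parent (A⊆D aw)
      ... | p , inj₁ refl , e , eq =
        contradiction (trans (sym (A-level aw)) (trans eq (cong suc level-v))) λ ()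
      ... | p , inj₂ dp , e , eq with parent dp
      ...   | τ , dτ , e′ , eq′ =
        τ , p , dτ , suc-injective (trans (sym eq′) lp) , inj₂ (dp , lp) , ~-sym e′ , e
        where
        lp : level p ≡ suc l″
        lp = suc-injective (trans (sym eq) (A-level aw))

      η : V → ℕ
      η w with A? w
      ... | yes aw = proj₁ (least (λ j → touch? j w) (touch-exists aw))
      ... | no _ = 0

      η-least : ∀ {w} → A w → Least (λ j → Touch j w) (η w)
      η-least {w} aw with A? w
      ... | yes aw′ = proj₂ (least (λ j → touch? j w) (touch-exists aw′))
      ... | no ¬aw = contradiction aw ¬aw

      η≤ : ∀ {w} → A w → η w ≤ l″
      η≤ aw = proj₂ (η-least aw) _ (touch-exists aw)

      Z≢low : ∀ {z y} → Z z → D⁺ y → level y ≤ l″ → z ≢ y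
      Z≢low (inj₁ xz) (inj₁ refl) _ refl = ¬Xv xz
      Z≢low (inj₁ xz) (inj₂ dy) _ refl = X∩D xz dy
      Z≢low (inj₂ (_ , eq)) _ le refl = <⇒≱ (≤-reflexive (sym eq)) le

      A≢Z : ∀ {w z} → A w → Z z → w ≢ z
      A≢Z aw (inj₁ xz) refl = X∩D xz (A⊆D aw)
      A≢Z aw (inj₂ (_ , eq)) refl = contradiction (trans (sym (A-level aw)) eq) λ ()

      A-low : ∀ {w y} → A w → D⁺ y → level y ≤ l″ → Apart w y
      A-low {w} {y} aw dy le = (λ { refl → <⇒≱ (≤-trans (n≤1+n _) (≤-reflexive (sym (A-level aw)))) le })
        , λ e → <⇒≱ (s≤s (s≤s le)) (subst (_≤ suc (level y)) (A-level aw) (level-≤ dy (A⊆D aw) (~-sym e)))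

      ZD⊎X : ∀ {z} → Z z → D z ⊎ X z
      ZD⊎X (inj₁ xz) = inj₂ xz
      ZD⊎X (inj₂ (dz , _)) = inj₁ dz

      -- Seen from `u`, the way to `v` through `z` and `τ` has `2 + t` edges, and the way through
      -- `k`, `z′` and `τ′` has `3 + t′`. By `contact`, `b` sees `z′`, `u` or `k`, while `¬zb` keeps
      -- it off `z`.
      module Gadget {t t′ τ τ′ z z′ u k b}
        (same : SameParity t t′) (t′≤t : t′ ≤ t) (t≤l″ : t ≤ l″)
        (dτ : D⁺ τ) (τ≡t : level τ ≡ t) (Zz : Z z) (zτ : z ~ τ) (zu : z ~ u)
        (z-low : ∀ {y} → D⁺ y → z ~ y → t ≤ level y)
        (dτ′ : D⁺ τ′) (τ′≡t′ : level τ′ ≡ t′) (Zz′ : Z z′) (z′τ′ : z′ ~ τ′) (z′k : z′ ~ k)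
        (z′-low : ∀ {y} → D⁺ y → z′ ~ y → t′ ≤ level y)
        (Au : A u) (Ak : A k) (Ab : A b) (uk : u ~ k) (¬zb : ¬ z ~ b)
        (t≤ηb : t ≤ η b) (contact : ¬ (¬ z′ ~ b × ¬ u ~ b × ¬ k ~ b))
        where

        Low : V → Set
        Low y = (D y × level y < t) ⊎ y ∈ˡ τ ∷ τ′ ∷ z ∷ z′ ∷ u ∷ k ∷ b ∷ []

        OnRoute : V → Set
        OnRoute y = (D y ⊎ (X y × (y ≡ z ⊎ y ≡ z′))) × Low y

        Good : List V → Set
        Good r = (∃ λ s → r ≡ b ∷ s) × Induced (r ++ v ∷ []) × (∀ {y} → y ∈ˡ r → OnRoute y)

        Routes : Set
        Routes = ∃ λ r → ∃ λ s → Good r × Good s × Odd (length r) × Even (length s)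

        private
          goτ = geodesic t dτ τ≡t
          goτ′ = geodesic t′ dτ′ τ′≡t′
          g g′ : List V
          g = proj₁ goτ
          g′ = proj₁ goτ′

          g-len : length g ≡ t
          g-len = proj₁ (proj₂ (proj₂ goτ))
          g′-len : length g′ ≡ t′
          g′-len = proj₁ (proj₂ (proj₂ goτ′))

          g-on : ∀ {y} → y ∈ˡ g → OnRoute y
          g-on i with proj₁ (proj₂ (proj₂ (proj₂ goτ))) i
          ... | dy , inj₁ refl = inj₁ dy , inj₂ (here refl)
          ... | dy , inj₂ lt = inj₁ dy , inj₁ (dy , lt)

          g′-on : ∀ {y} → y ∈ˡ g′ → OnRoute y
          g′-on i with proj₁ (proj₂ (proj₂ (proj₂ goτ′))) i
          ... | dy , inj₁ refl = inj₁ dy , inj₂ (there (here refl))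
          ... | dy , inj₂ lt = inj₁ dy , inj₁ (dy , ≤-trans lt t′≤t)

          r r′ : List V
          r = proj₁ (proj₂ (proj₂ (proj₂ (proj₂ goτ))))
          r′ = proj₁ (proj₂ (proj₂ (proj₂ (proj₂ goτ′))))

          g≡ : g ++ v ∷ [] ≡ τ ∷ r
          g≡ = proj₁ (proj₂ (proj₂ (proj₂ (proj₂ (proj₂ goτ)))))
          g′≡ : g′ ++ v ∷ [] ≡ τ′ ∷ r′
          g′≡ = proj₁ (proj₂ (proj₂ (proj₂ (proj₂ (proj₂ goτ′)))))

          low : ∀ {y} → y ∈ˡ r → D⁺ y × level y < t
          low = proj₂ (proj₂ (proj₂ (proj₂ (proj₂ (proj₂ goτ)))))
          low′ : ∀ {y} → y ∈ˡ r′ → D⁺ y × level y < t′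
          low′ = proj₂ (proj₂ (proj₂ (proj₂ (proj₂ (proj₂ goτ′)))))

          onτ : ∀ {y} → y ∈ˡ g ++ v ∷ [] → D⁺ y × level y ≤ l″
          onτ i with subst (_ ∈ˡ_) g≡ i
          ... | here refl = dτ , subst (_≤ l″) (sym τ≡t) t≤l″
          ... | there j = proj₁ (low j) , ≤-trans (<⇒≤ (proj₂ (low j))) t≤l″

          onτ′ : ∀ {y} → y ∈ˡ g′ ++ v ∷ [] → D⁺ y × level y ≤ l″
          onτ′ i with subst (_ ∈ˡ_) g′≡ i
          ... | here refl = dτ′ , subst (_≤ l″) (sym τ′≡t′) (≤-trans t′≤t t≤l″)
          ... | there j = proj₁ (low′ j) , ≤-trans (<⇒≤ (proj₂ (low′ j))) (≤-trans t′≤t t≤l″)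

          A-g : ∀ {w} → A w → ∀ {y} → y ∈ˡ g ++ v ∷ [] → Apart w y
          A-g aw i = A-low aw (proj₁ (onτ i)) (proj₂ (onτ i))

          A-g′ : ∀ {w} → A w → ∀ {y} → y ∈ˡ g′ ++ v ∷ [] → Apart w y
          A-g′ aw i = A-low aw (proj₁ (onτ′ i)) (proj₂ (onτ′ i))

          pz : Induced (z ∷ g ++ v ∷ [])
          pz = consHead g≡ zτ (λ i → let dy , lt = low i in
            Z≢low Zz dy (≤-trans (<⇒≤ lt) t≤l″) , λ e → <⇒≱ lt (z-low dy e)) (proj₁ (proj₂ goτ))

          pz′ : Induced (z′ ∷ g′ ++ v ∷ [])
          pz′ = consHead g′≡ z′τ′ (λ i → let dy , lt = low′ i in
            Z≢low Zz′ dy (≤-trans (<⇒≤ lt) (≤-trans t′≤t t≤l″)) , λ e → <⇒≱ lt (z′-low dy e)) (proj₁ (proj₂ goτ′))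

          z-on : OnRoute z
          z-on = [ inj₁ , (λ x → inj₂ (x , inj₁ refl)) ]′ (ZD⊎X Zz) , inj₂ (there (there (here refl)))
          z′-on : OnRoute z′
          z′-on = [ inj₁ , (λ x → inj₂ (x , inj₂ refl)) ]′ (ZD⊎X Zz′) , inj₂ (there (there (there (here refl))))
          u-on : OnRoute u
          u-on = inj₁ (A⊆D Au) , inj₂ (there (there (there (there (here refl)))))
          k-on : OnRoute k
          k-on = inj₁ (A⊆D Ak) , inj₂ (there (there (there (there (there (here refl))))))
          b-on : OnRoute b
          b-on = inj₁ (A⊆D Ab) , inj₂ (there (there (there (there (there (there (here refl)))))))

          _∷ᵒ_ : ∀ {x l} → OnRoute x → (∀ {y} → y ∈ˡ l → OnRoute y) → ∀ {y} → y ∈ˡ x ∷ l → OnRoute y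
          (ox ∷ᵒ ol) (here refl) = ox
          (ox ∷ᵒ ol) (there i) = ol i
          infixr 5 _∷ᵒ_

          _∷ᵃ_ : ∀ {w x l} → Apart w x → (∀ {y} → y ∈ˡ l → Apart w y) → ∀ {y} → y ∈ˡ x ∷ l → Apart w y
          (ax ∷ᵃ al) (here refl) = ax
          (ax ∷ᵃ al) (there i) = al i
          infixr 5 _∷ᵃ_

          u≁z′ : ¬ u ~ z′
          u≁z′ e = noTriangle uk (~-sym z′k) (~-sym e)
          k≁z : ¬ k ~ z
          k≁z e = noTriangle zu uk e
          u≢b : u ≢ b
          u≢b refl = ¬zb zu

          puk : Induced (k ∷ u ∷ z ∷ g ++ v ∷ [])
          puk = consHead refl (~-sym uk) ((A≢Z Ak Zz , k≁z) ∷ᵃ A-g Ak)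
               (consHead refl (~-sym zu) (A-g Au) pz)

          bz : Apart b z
          bz = A≢Z Ab Zz , λ e → ¬zb (~-sym e)

          order : ∀ i j {r s} → Odd (i + j) → length r ≡ i + t → length s ≡ j + t′ →
            Good r → Good s → Routes
          order i j o er es gr gs with opposite same i j o
          ... | inj₁ (or , es′) = _ , _ , gr , gs , subst Odd (sym er) or , subst Even (sym es) es′
          ... | inj₂ (er′ , os) = _ , _ , gs , gr , subst Odd (sym es) os , subst Even (sym er) er′

          -- z′ ~ b forces t′ = t, so z′ could meet the geodesic to τ only in τ, closing a pentagon.
          z′-g : z′ ~ b → ∀ {y} → y ∈ˡ g ++ v ∷ [] → Apart z′ y
          z′-g z′b i = Z≢low Zz′ (proj₁ (onτ i)) (proj₂ (onτ i)) , off (subst (_ ∈ˡ_) g≡ i)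
            where
            t≤t′ : t ≤ t′
            t≤t′ = ≤-trans t≤ηb (proj₂ (η-least Ab) t′ (τ′ , z′ , dτ′ , τ′≡t′ , Zz′ , z′τ′ , z′b))
            off : ∀ {y} → y ∈ˡ τ ∷ r → ¬ z′ ~ y
            off (here refl) e = noPentagon (~-sym zτ) zu uk (~-sym z′k) e
            off (there j) e = let dy , lt = low j in <⇒≱ lt (≤-trans t≤t′ (z′-low dy e))

        -- In `order i j` the numbers count the route vertices outside the geodesics to `τ` and
        -- `τ′`. A route omits `v`, so the length of its list is its number of edges. As `i + j` is
        -- 5 or 7 in every case and `t` and `t′` agree in parity, exactly one route is odd.
        routes : Routes
        routes with u ~? b | k ~? b | z′ ~? b
        ... | yes ub | _ | yes z′b = order 3 2 (2 , refl)
          (cong (3 +_) g-len) (cong (2 +_) g′-len)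
          ((_ , refl) , consHead refl (~-sym ub) (bz ∷ᵃ A-g Ab) (consHead refl (~-sym zu) (A-g Au) pz)
            , b-on ∷ᵒ u-on ∷ᵒ z-on ∷ᵒ g-on)
          ((_ , refl) , consHead refl (~-sym z′b) (A-g′ Ab) pz′ , b-on ∷ᵒ z′-on ∷ᵒ g′-on)
        ... | yes ub | _ | no ¬z′b = order 3 4 (3 , refl)
          (cong (3 +_) g-len) (cong (4 +_) g′-len)
          ((_ , refl) , consHead refl (~-sym ub) (bz ∷ᵃ A-g Ab) (consHead refl (~-sym zu) (A-g Au) pz)
            , b-on ∷ᵒ u-on ∷ᵒ z-on ∷ᵒ g-on)
          ((_ , refl)
            , consHead refl (~-sym ub)
                (((λ { refl → ¬z′b z′k }) , λ e → noTriangle ub e (~-sym uk))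
                 ∷ᵃ (A≢Z Ab Zz′ , λ e → ¬z′b (~-sym e)) ∷ᵃ A-g′ Ab)
                (consHead refl uk ((A≢Z Au Zz′ , u≁z′) ∷ᵃ A-g′ Au)
                (consHead refl (~-sym z′k) (A-g′ Ak) pz′))
            , b-on ∷ᵒ u-on ∷ᵒ k-on ∷ᵒ z′-on ∷ᵒ g′-on)
        ... | no ¬ub | yes kb | _ = order 4 3 (3 , refl)
          (cong (4 +_) g-len) (cong (3 +_) g′-len)
          ((_ , refl)
            , consHead refl (~-sym kb) (((λ eq → u≢b (sym eq)) , λ e → ¬ub (~-sym e)) ∷ᵃ bz ∷ᵃ A-g Ab) puk
            , b-on ∷ᵒ k-on ∷ᵒ u-on ∷ᵒ z-on ∷ᵒ g-on)
          ((_ , refl)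
            , consHead refl (~-sym kb) ((A≢Z Ab Zz′ , λ e → noTriangle kb e z′k) ∷ᵃ A-g′ Ab)
                (consHead refl (~-sym z′k) (A-g′ Ak) pz′)
            , b-on ∷ᵒ k-on ∷ᵒ z′-on ∷ᵒ g′-on)
        ... | no ¬ub | no ¬kb | no ¬z′b = contradiction (¬z′b , ¬ub , ¬kb) contact
        -- With `z′` as the only contact, the longer route must get from `z′` to `z`: along their
        -- edge if there is one, otherwise through `k` and `u`.
        ... | no ¬ub | no ¬kb | yes z′b with z ~? z′
        ...   | yes zz′ = order 3 2 (2 , refl)
          (cong (3 +_) g-len) (cong (2 +_) g′-len)
          ((_ , refl) , consHead refl (~-sym z′b) (bz ∷ᵃ A-g Ab)
              (consHead refl (~-sym zz′) (z′-g z′b) pz)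
            , b-on ∷ᵒ z′-on ∷ᵒ z-on ∷ᵒ g-on)
          ((_ , refl) , consHead refl (~-sym z′b) (A-g′ Ab) pz′ , b-on ∷ᵒ z′-on ∷ᵒ g′-on)
        ...   | no ¬zz′ = order 5 2 (3 , refl)
          (cong (5 +_) g-len) (cong (2 +_) g′-len)
          ((_ , refl)
            , consHead refl (~-sym z′b)
                (((λ { refl → ¬ub uk }) , λ e → ¬kb (~-sym e))
                 ∷ᵃ ((λ eq → u≢b (sym eq)) , λ e → ¬ub (~-sym e)) ∷ᵃ bz ∷ᵃ A-g Ab)
                (consHead refl z′k
                  (((λ eq → A≢Z Au Zz′ (sym eq)) , λ e → u≁z′ (~-sym e))
                   ∷ᵃ ((λ { refl → ¬zb z′b }) , λ e → ¬zz′ (~-sym e)) ∷ᵃ z′-g z′b)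
                puk)
            , b-on ∷ᵒ z′-on ∷ᵒ k-on ∷ᵒ u-on ∷ᵒ z-on ∷ᵒ g-on)
          ((_ , refl) , consHead refl (~-sym z′b) (A-g′ Ab) pz′ , b-on ∷ᵒ z′-on ∷ᵒ g′-on)

      module Class {B : V → Set} (B? : Decidable B) (B⊆A : ∀ {w} → B w → A w)
        (parity : ∀ {u w} → B u → B w → SameParity (η u) (η w)) where

        -- Once the strict local minima are gone, a vertex u of least η still has a neighbour k with
        -- η k ≤ η u. So both routes leave the tree at or below level η u, while a vertex of X adjacent to
        -- what remains can only meet the tree at that level or above, hence meets the routes only near b.
        LocalMin : V → Set
        LocalMin w = ∀ w′ → B w′ → w ~ w′ → η w < η w′

        localMin? : Decidable LocalMin
        localMin? w = all? λ w′ → B? w′ →-dec (w ~? w′) →-dec (η w <? η w′)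

        localMin-col : Col (λ w → B w × LocalMin w) 1
        localMin-col = (λ _ → 0) , (λ _ _ → s≤s z≤n) ,
          λ u w (bu , mu) (bw , mw) e _ → <-asym (mu w bw e) (mw u bu (~-sym e))

        -- Deletion has two stages because `u` must see `z` and `b` must not. Deleting the
        -- neighbours of `z` leaves `E`; a walk back to `b₀`, a neighbour of `z`, leaves `E` at `u`,
        -- which therefore sees `z`. Deleting the neighbours of `z′`, `u` and `k` leaves `E₂` inside
        -- `E`; a walk to `e`, a neighbour of `u`, leaves `E₂` at `b`. This `b` is still in `E`, so
        -- it misses `z` and sees one of the other three.
        link : ∀ {c} → ¬ Col B (1 + (2 + (2 + (2 + (2 + c))))) → Link A c
        link {c} ¬colB = inF (bigComponent F₀? (remove localMin? localMin-col ¬colB))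
          where
          F₀ : V → Set
          F₀ w = B w × ¬ LocalMin w
          F₀? : Decidable F₀
          F₀? w = B? w ×-dec ¬? (localMin? w)

          -- `k` is found in `B` only, since it may be one of the deleted local minima. Hence `η k`
          -- can be smaller than the minimum over `F`, but its parity is still controlled.
          lower : ∀ {u} → F₀ u → ∃ λ k → B k × u ~ k × η k ≤ η u
          lower {u} (bu , ¬m) with any? (λ k → B? k ×-dec (u ~? k) ×-dec (η k ≤? η u))
          ... | yes r = r
          ... | no none = contradiction
            (λ k bk e → ≰⇒> λ le → none (k , bk , e , le)) ¬m

          inF : (∃ λ a → F₀ a × ¬ Col (Reach F₀ a) (2 + (2 + (2 + (2 + c))))) → Link A c
          inF (a , fa , ¬colF) = atMin (argmin F? η (nonempty F? ¬colF))
            where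
            F : V → Set
            F = Reach F₀ a
            F? : Decidable F
            F? = reach? F₀? a
            F⊆F₀ : ∀ {w} → F w → F₀ w
            F⊆F₀ = reach-in fa
            F⊆B : ∀ {w} → F w → B w
            F⊆B f = proj₁ (F⊆F₀ f)
            F⊆A : ∀ {w} → F w → A w
            F⊆A f = B⊆A (F⊆B f)

            atMin : (∃ λ b₀ → F b₀ × (∀ w → F w → η b₀ ≤ η w)) → Link A c
            atMin (b₀ , fb₀ , min) = viaZ (proj₁ (η-least (F⊆A fb₀)))
              where
              t : ℕ
              t = η b₀
              t≤l″ : t ≤ l″
              t≤l″ = η≤ (F⊆A fb₀)
              viaZ : Touch t b₀ → Link A c
              viaZ (τ , z , dτ , τ≡t , Zz , zτ , zb₀) =
                inE (bigComponent F₁? (remove (z ~?_) (neighbours-col z) ¬colF))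
                where
                F₁ : V → Set
                F₁ w = F w × ¬ z ~ w
                F₁? : Decidable F₁
                F₁? w = F? w ×-dec ¬? (z ~? w)
                inE : (∃ λ e₀ → F₁ e₀ × ¬ Col (Reach F₁ e₀) (2 + (2 + (2 + c)))) → Link A c
                inE (e₀ , fe₀ , ¬colE) =
                  atU (exit E? (reach-trans (reach-sym fa (proj₁ fe₀)) fb₀) here
                        λ eb₀ → proj₂ (reach-in fe₀ eb₀) zb₀)
                  where
                  E : V → Set
                  E = Reach F₁ e₀
                  E? : Decidable E
                  E? = reach? F₁? e₀
                  E⊆F₁ : ∀ {w} → E w → F₁ w
                  E⊆F₁ = reach-in fe₀
                  atU : (∃ λ e → ∃ λ u → E e × Reach F₀ e₀ u × F₀ u × ¬ E u × e ~ u) → Link A c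
                  atU (e , u , Ee , ru , F₀u , ¬Eu , eu) = atK (lower F₀u)
                    where
                    Fu : F u
                    Fu = reach-trans (proj₁ fe₀) ru
                    Au : A u
                    Au = F⊆A Fu
                    zu : z ~ u
                    zu = decidable-stable (z ~? u) λ ¬zu → ¬Eu (step Ee (Fu , ¬zu) eu)
                    -- `z` sees `τ` and `u`, so `u` touches level `t` through it.
                    ηu≤t : η u ≤ t
                    ηu≤t = proj₂ (η-least Au) t (τ , z , dτ , τ≡t , Zz , zτ , zu)
                    atK : (∃ λ k → B k × u ~ k × η k ≤ η u) → Link A c
                    atK (k , Bk , uk , ηk≤ηu) = viaZ′ (proj₁ (η-least Ak))
                      where
                      Ak : A k
                      Ak = B⊆A Bk
                      t′ : ℕ
                      t′ = η k
                      t′≤t : t′ ≤ t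
                      t′≤t = ≤-trans ηk≤ηu ηu≤t
                      viaZ′ : Touch t′ k → Link A c
                      viaZ′ (τ′ , z′ , dτ′ , τ′≡t′ , Zz′ , z′τ′ , z′k) =
                        inE₂ (bigComponent E₃?
                          (remove (k ~?_) (neighbours-col k)
                          (remove (u ~?_) (neighbours-col u)
                          (remove (z′ ~?_) (neighbours-col z′) ¬colE))))
                        where
                        E₃ : V → Set
                        E₃ w = ((E w × ¬ z′ ~ w) × ¬ u ~ w) × ¬ k ~ w
                        E₃? : Decidable E₃
                        E₃? w = ((E? w ×-dec ¬? (z′ ~? w)) ×-dec ¬? (u ~? w)) ×-dec ¬? (k ~? w)
                        inE₂ : (∃ λ f₀ → E₃ f₀ × ¬ Col (Reach E₃ f₀) c) → Link A c
                        inE₂ (f₀ , ef₀ , ¬colE₂) =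
                          atB (exit E₂? (reach-trans (reach-sym fe₀ (proj₁ (proj₁ (proj₁ ef₀)))) Ee) here
                                λ E₂e → proj₂ (proj₁ (E₂⊆E₃ E₂e)) (~-sym eu))
                          where
                          E₂ : V → Set
                          E₂ = Reach E₃ f₀
                          E₂? : Decidable E₂
                          E₂? = reach? E₃? f₀
                          E₂⊆E₃ : ∀ {w} → E₂ w → E₃ w
                          E₂⊆E₃ = reach-in ef₀
                          E₂⊆F₁ : ∀ {w} → E₂ w → F₁ w
                          E₂⊆F₁ p = E⊆F₁ (proj₁ (proj₁ (proj₁ (E₂⊆E₃ p))))
                          E₂⊆A : ∀ {w} → E₂ w → A w
                          E₂⊆A p = F⊆A (proj₁ (E₂⊆F₁ p))
                          atB : (∃ λ e₂ → ∃ λ b → E₂ e₂ × Reach F₁ f₀ b × F₁ b × ¬ E₂ b × e₂ ~ b) → Link A c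
                          atB (e₂ , b , E₂e₂ , rb , (Fb , ¬zb) , ¬E₂b , e₂b) = assemble routes
                            where
                            Eb : E b
                            Eb = reach-trans (proj₁ (proj₁ (proj₁ ef₀))) rb
                            Ab : A b
                            Ab = F⊆A Fb
                            near-gadget : ¬ z′ ~ b → ¬ u ~ b → ¬ k ~ b → ⊥
                            near-gadget p q r = ¬E₂b (step E₂e₂ (((Eb , p) , q) , r) e₂b)

                            open Gadget {t} {t′} {τ} {τ′} {z} {z′} {u} {k} {b}
                              (parity (F⊆B fb₀) Bk) t′≤t t≤l″ dτ τ≡t Zz zτ zu
                              -- A tree neighbour of `z` below level `t` would lower `η b₀`, because
                              -- `z` sees `b₀`. The same holds below for `z′` and `k`.
                              (λ dy zy → proj₂ (η-least (F⊆A fb₀)) _ (_ , z , dy , refl , Zz , zy , zb₀))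
                              dτ′ τ′≡t′ Zz′ z′τ′ z′k
                              (λ dy zy → proj₂ (η-least Ak) _ (_ , z′ , dy , refl , Zz′ , zy , z′k))
                              Au Ak Ab uk ¬zb (min b Fb) (λ (p , q , r) → near-gadget p q r)

                            assemble : Routes → Link A c
                            assemble (r , s , (rh , ri , rin) , (sh , si , sin) , odd , even) = record
                              { b = b ; τ = τ ; τ′ = τ′ ; z = z ; z′ = z′ ; u = u ; k = k ; t = t
                              ; E = E₂ ; E? = E₂? ; E⊆A = E₂⊆A ; big = ¬colE₂
                              ; conn = λ {w} p → reach-trans
                                  (reach-trans (step here E₂e₂ (~-sym e₂b)) (reach-sym here (reach-self E₂e₂)))
                                  (reach-self p)
                              ; Ab = Ab ; ¬Eb = ¬E₂b
                              ; route = λ { zero → r ; (suc zero) → s }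
                              ; route-head = λ { zero → rh ; (suc zero) → sh }
                              ; route-induced = λ { zero → ri ; (suc zero) → si }
                              ; route-odd = odd ; route-even = even
                              ; route-in = λ { zero → rin ; (suc zero) → sin }
                              ; apart = apart
                              -- `x` is an admissible intermediate vertex between `w` and `y`, so
                              -- `η w` is at most `level y`, and `t` is the minimum of `η` on `F`.
                              ; height = λ p xx xw dy xy → ≤-trans (min _ (proj₁ (E₂⊆F₁ p)))
                                  (proj₂ (η-least (E₂⊆A p)) _ (_ , _ , dy , refl , inj₁ xx , xy , xw))
                              ; τ-v = λ t≡0 → level0⇒v dτ (trans τ≡t t≡0)
                              ; zτ = zτ ; z′τ′ = z′τ′ ; zu = zu ; z′k = z′k }
                              where
                              apart : ∀ {w y} → E₂ w → Low y → y ≢ b → Apart w y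
                              apart p (inj₁ (dy , lt)) _ = A-low (E₂⊆A p) (inj₂ dy) (≤-trans (<⇒≤ lt) t≤l″)
                              apart p (inj₂ (here refl)) _ = A-low (E₂⊆A p) dτ (subst (_≤ l″) (sym τ≡t) t≤l″)
                              apart p (inj₂ (there (here refl))) _ =
                                A-low (E₂⊆A p) dτ′ (subst (_≤ l″) (sym τ′≡t′) (≤-trans t′≤t t≤l″))
                              apart p (inj₂ (there (there (here refl)))) _ =
                                A≢Z (E₂⊆A p) Zz , λ e → proj₂ (E₂⊆F₁ p) (~-sym e)
                              apart p (inj₂ (there (there (there (here refl))))) _ =
                                A≢Z (E₂⊆A p) Zz′ , λ e → proj₂ (proj₁ (proj₁ (E₂⊆E₃ p))) (~-sym e)
                              apart p (inj₂ (there (there (there (there (here refl)))))) _ =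
                                (λ { refl → proj₂ (E₂⊆F₁ p) zu }) , λ e → proj₂ (proj₁ (E₂⊆E₃ p)) (~-sym e)
                              apart p (inj₂ (there (there (there (there (there (here refl))))))) _ =
                                (λ { refl → proj₂ (proj₁ (E₂⊆E₃ p)) uk }) , λ e → proj₂ (E₂⊆E₃ p) (~-sym e)
                              apart p (inj₂ (there (there (there (there (there (there (here refl)))))))) ¬b =
                                contradiction refl ¬b

-- Chains of links and the invariant that they carry.

sameParity⇒≡ : ∀ {j k} → SameParity j k → j ≤ suc k → k ≤ suc j → j ≡ k
sameParity⇒≡ {j} {k} p j≤ k≤ with m≤n⇒m<n∨m≡n j≤ | m≤n⇒m<n∨m≡n k≤
... | inj₁ lt | inj₁ lt′ = ≤-antisym (≤-pred lt) (≤-pred lt′)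
sameParity⇒≡ (inj₁ (ej , ek)) _ _ | inj₂ refl | _ = contradiction (even⇒odd ek) (¬even×odd ej)
sameParity⇒≡ (inj₂ (oj , ok)) _ _ | inj₂ refl | _ = contradiction oj (¬even×odd (odd⇒even ok))
sameParity⇒≡ (inj₁ (ej , ek)) _ _ | _ | inj₂ refl = contradiction (even⇒odd ej) (¬even×odd ek)
sameParity⇒≡ (inj₂ (oj , ok)) _ _ | _ | inj₂ refl = contradiction ok (¬even×odd (odd⇒even oj))

-- The local minima cost 1 colour; the neighbourhoods of z, z′, u, k and the balls around z, z′ cost
-- 2 each. In grow, one 2 pays for the ball around v, and two halvings fix the parities of level and η.
cost : ℕ → ℕ
cost c = 1 + (2 + (2 + (2 + (2 + (2 + (2 + c))))))

grow : ℕ → ℕ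
grow c = 2 + ((cost c + cost c) + (cost c + cost c))

module Chains (G : Graph) (og : OddGirth≥ G 11) (Y : Fin (n G) → Set) where
  open LinkLemma G og public

  parityClass : ∀ {A : V → Set} {s} → Decidable A → (f : V → ℕ) → ¬ Col A (s + s) →
    Σ (V → Set) λ B → Decidable B × (∀ {w} → B w → A w) × ¬ Col B s
      × (∀ {u w} → B u → B w → SameParity (f u) (f w))
  parityClass {A} {s} A? f ¬c with col? (λ w → A? w ×-dec even? (f w)) s
  ... | no ¬e = _ , (λ w → A? w ×-dec even? (f w)) , proj₁ , ¬e , λ (_ , e) (_ , e′) → inj₁ (e , e′)
  ... | yes e = _ , (λ w → A? w ×-dec ¬? (even? (f w))) , proj₁
    , remove (λ w → even? (f w)) e ¬c
    , λ (_ , o) (_ , o′) → inj₂ (¬even⇒odd o , ¬even⇒odd o′)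

  -- A route from v to the new end b is listed from b backwards and omits v.
  data Chain (q : V) : ℕ → V → Set
  -- Both routes of every link are included, so being off the chain covers all choices of routes at
  -- once.
  OnChain : ∀ {q i v} → Chain q i v → V → Set
  joints : ∀ {q i v} → Chain q i v → List V

  data Chain q where
    start : Chain q 0 q
    extend : ∀ {i v} (c : Chain q i v) {b} (route : Fin 2 → List V) →
      (∀ h → ∃ λ s → route h ≡ b ∷ s) →
      (∀ h → Induced (route h ++ v ∷ [])) →
      Odd (length (route zero)) → Even (length (route (suc zero))) →
      (∀ h {y a} → y ∈ˡ route h → OnChain c a → y ≢ a × (a ≢ v → ¬ y ~ a)) →
      (∀ {a} → a ∈ˡ joints c → ¬ Near a b) →
      (∀ h {y} → y ∈ˡ route h → Y y) →
      Chain q (suc i) b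

  OnChain {q} start a = a ≡ q
  OnChain (extend c route _ _ _ _ _ _ _) a = (∃ λ h → a ∈ˡ route h) ⊎ OnChain c a

  joints {q} start = q ∷ []
  joints (extend c {b} _ _ _ _ _ _ _ _) = b ∷ joints c

  chain-end : ∀ {q i v} (c : Chain q i v) → OnChain c v
  chain-end start = refl
  chain-end (extend c {b} route hd _ _ _ _ _ _) with hd zero
  ... | s , eq = inj₁ (zero , subst (b ∈ˡ_) (sym eq) (here refl))

  -- D is the unexplored part, entered from v. Every x in X leads through P and R back to q, avoiding
  -- all of the chain but its ends, so the chain can be closed up at any vertex of D with a neighbour in X.
  -- Keeping P apart from R matters: X may touch P, but R is out of reach of D and X for ever.
  record State (q : V) (i c : ℕ) : Set₁ where
    field
      {v} : V
      chain : Chain q i v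
      D X P R : V → Set
      D? : Decidable D
      X? : Decidable X
      P? : Decidable P
      reach : ∀ {d} → D d → Reach D v d
      D-chain : ∀ {d a} → D d → OnChain chain a → d ≢ a × (a ≢ v → ¬ d ~ a)
      X-chain : ∀ {x a} → X x → OnChain chain a → x ≢ a × (a ≢ v → ¬ x ~ a)
      X∩D : ∀ {x} → X x → ¬ D x
      P-chain : ∀ {p a} → P p → OnChain chain a → Apart p a
      P-D : ∀ {p d} → P p → D d → Apart p d
      X-P : ∀ {x} → X x → ∃ λ p → P p × x ~ p
      R-chain : ∀ {y a} → R y → OnChain chain a → y ≢ a × (a ≢ q → ¬ y ~ a)
      R-D : ∀ {y d} → R y → D d → Apart y d
      R-X : ∀ {y x} → R y → X x → Apart y x
      P-R : ∀ {p} → P p → ∃ λ y → R y × p ~ y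
      R-q : ∀ {y} → R y → Reach R q y
      -- The current end `v` is exempt: the next extension begins by deleting its ball.
      far : ∀ {a d} → a ∈ˡ joints chain → a ≢ v → D d → ¬ Near a d
      big : ¬ Col (λ w → D w × ∃ λ x → X x × x ~ w) c
      q∈Y : Y q
      D⊆Y : ∀ {y} → D y → Y y
      X⊆Y : ∀ {y} → X y → Y y
      P⊆Y : ∀ {y} → P y → Y y
      R⊆Y : ∀ {y} → R y → Y y

  -- Deleting the ball around `v` keeps the corners far apart and also pushes the rest beyond level
  -- 1, out of sight of `v`. Neighbours in one parity class of `level` share their level, so
  -- isolating a level costs no more than that halving.
  advance : ∀ {q i c} → State q i (grow c) → State q (suc i) c
  advance {q} {i} {c} S = atParity (parityClass A₁? level (remove (near? v) near-v big))
    where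
    open State S
    ¬Dv : ¬ D v
    ¬Dv dv = proj₁ (D-chain dv (chain-end chain)) refl
    ¬Xv : ¬ X v
    ¬Xv xv = proj₁ (X-chain xv (chain-end chain)) refl
    open Step D? v ¬Dv reach X? X∩D ¬Xv
    A₁ : V → Set
    A₁ w = (D w × ∃ λ x → X x × x ~ w) × ¬ Near v w
    A₁? : Decidable A₁
    A₁? w = (D? w ×-dec any? λ x → X? x ×-dec (x ~? w)) ×-dec ¬? (near? v w)
    near-v : Col (λ w → (D w × ∃ λ x → X x × x ~ w) × Near v w) 2
    near-v = col-mono (λ _ → proj₂) ≤-refl (near-col v)

    finish : ∀ {A} → (∀ {w} → A w → A₁ w) → (∀ {w} → A w → ¬ level w ≤ 1) →
      Link A (2 + (2 + c)) → State q (suc i) c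
    finish {A} A⊆A₁ deep L = record
      { chain = extend chain route route-head route-induced route-odd route-even fresh
          (λ {a} j → farA j Ab) (λ h y∈ → DX⊆Y (proj₁ (route-in h y∈)))
      ; D = E ; X = X′ ; P = P′ ; R = R
      ; D? = E?
      ; X? = X′?
      ; P? = P′?
      ; reach = conn
      ; D-chain = D-chain′
      ; X-chain = X-chain′
      ; X∩D = λ x e → X∩D (proj₁ x) (E⊆D e)
      ; P-chain = P-chain′
      ; P-D = λ p e → P-D (proj₁ p) (E⊆D e)
      ; X-P = λ x → proj₂ (proj₂ (proj₂ (proj₂ (proj₂ x))))
      ; R-chain = R-chain′
      ; R-D = λ y e → R-D y (E⊆D e)
      ; R-X = λ y x → R-X y (proj₁ x)
      ; P-R = λ p → P-R (proj₁ p)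
      ; R-q = R-q
      ; far = λ { (here refl) a≢b _ → contradiction refl a≢b ; (there j) _ e → farA j (E⊆A e) }
      ; big = λ col → remove (near? z′) (col-mono (λ _ → proj₂) ≤-refl (near-col z′))
          (remove (near? z) (col-mono (λ _ → proj₂) ≤-refl (near-col z)) bigE) (col-mono keep ≤-refl col)
      ; q∈Y = q∈Y
      ; D⊆Y = λ e → D⊆Y (E⊆D e)
      ; X⊆Y = λ x → X⊆Y (proj₁ x)
      ; P⊆Y = λ p → P⊆Y (proj₁ p)
      ; R⊆Y = R⊆Y
      }
      where
      open Link L renaming (big to bigE)
      A⊆D : ∀ {w} → A w → D w
      A⊆D a = proj₁ (proj₁ (A⊆A₁ a))
      E⊆D : ∀ {w} → E w → D w
      E⊆D e = A⊆D (E⊆A e)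
      DX⊆Y : ∀ {y} → D y ⊎ (X y × (y ≡ z ⊎ y ≡ z′)) → Y y
      DX⊆Y = [ D⊆Y , (λ x → X⊆Y (proj₁ x)) ]′
      P′ X′ : V → Set
      -- `z` and `z′` may come from `X` and join the chain, and `P` was free to touch `X`. `R`
      -- avoids `X` and can stay as it is.
      P′ p = P p × (p ≢ z × ¬ p ~ z) × (p ≢ z′ × ¬ p ~ z′)
      P′? : Decidable P′
      P′? p = P? p ×-dec (¬? (p ≟ᶠ z) ×-dec ¬? (p ~? z)) ×-dec (¬? (p ≟ᶠ z′) ×-dec ¬? (p ~? z′))
      X′ x = X x × x ≢ z × x ≢ z′ × ¬ x ~ v × (∀ y → Low y → y ≢ b → ¬ x ~ y) × ∃ λ p → P′ p × x ~ p
      low? : Decidable Low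
      low? y = (D? y ×-dec (level y <? t)) ⊎-dec Any.any? (y ≟ᶠ_) _
      X′? : Decidable X′
      X′? x = X? x ×-dec ¬? (x ≟ᶠ z) ×-dec ¬? (x ≟ᶠ z′) ×-dec ¬? (x ~? v)
        ×-dec all? (λ y → low? y →-dec ¬? (y ≟ᶠ b) →-dec ¬? (x ~? y))
        ×-dec any? λ p → P′? p ×-dec (x ~? p)
      farA : ∀ {a w} → a ∈ˡ joints chain → A w → ¬ Near a w
      farA {a} j aw with a ≟ᶠ v
      ... | yes refl = proj₂ (A⊆A₁ aw)
      ... | no a≢v = far j a≢v (A⊆D aw)
      fresh : ∀ h {y a} → y ∈ˡ route h → OnChain chain a → y ≢ a × (a ≢ v → ¬ y ~ a)
      fresh h y∈ a∈ with proj₁ (route-in h y∈)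
      ... | inj₁ dy = D-chain dy a∈
      ... | inj₂ (xy , _) = X-chain xy a∈
      D-chain′ : ∀ {d a} → E d → (∃ λ h → a ∈ˡ route h) ⊎ OnChain chain a → d ≢ a × (a ≢ b → ¬ d ~ a)
      D-chain′ {d} {a} e (inj₁ (h , a∈)) with a ≟ᶠ b
      ... | yes refl = (λ { refl → ¬Eb e }) , λ a≢b → contradiction refl a≢b
      ... | no a≢b = let p , q = apart e (proj₂ (route-in h a∈)) a≢b in p , λ _ → q
      D-chain′ {d} {a} e (inj₂ a∈) = proj₁ (D-chain (E⊆D e) a∈) , λ _ → go
        where
        go : ¬ d ~ a
        go da with a ≟ᶠ v
        ... | yes refl = deep (E⊆A e) (subst (λ l → level d ≤ suc l) level-v
                (level-≤ (inj₁ refl) (E⊆D e) (~-sym da)))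
        ... | no a≢v = proj₂ (D-chain (E⊆D e) a∈) a≢v da
      X-chain′ : ∀ {x a} → X′ x → (∃ λ h → a ∈ˡ route h) ⊎ OnChain chain a → x ≢ a × (a ≢ b → ¬ x ~ a)
      X-chain′ {x} {a} (xx , x≢z , x≢z′ , _ , off , _) (inj₁ (h , a∈)) =
        distinct (proj₁ (route-in h a∈)) , off a (proj₂ (route-in h a∈))
        where
        distinct : D a ⊎ (X a × (a ≡ z ⊎ a ≡ z′)) → x ≢ a
        distinct (inj₁ da) refl = X∩D xx da
        distinct (inj₂ (_ , inj₁ refl)) = x≢z
        distinct (inj₂ (_ , inj₂ refl)) = x≢z′
      X-chain′ {x} {a} (xx , _ , _ , ¬xv , _) (inj₂ a∈) = proj₁ (X-chain xx a∈) , λ _ → go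
        where
        go : ¬ x ~ a
        go xa with a ≟ᶠ v
        ... | yes refl = ¬xv xa
        ... | no a≢v = proj₂ (X-chain xx a∈) a≢v xa
      P-chain′ : ∀ {p a} → P′ p → (∃ λ h → a ∈ˡ route h) ⊎ OnChain chain a → Apart p a
      P-chain′ (pp , pz , pz′) (inj₁ (h , a∈)) with proj₁ (route-in h a∈)
      ... | inj₁ da = P-D pp da
      ... | inj₂ (_ , inj₁ refl) = pz
      ... | inj₂ (_ , inj₂ refl) = pz′
      P-chain′ (pp , _) (inj₂ a∈) = P-chain pp a∈
      R-chain′ : ∀ {y a} → R y → (∃ λ h → a ∈ˡ route h) ⊎ OnChain chain a → y ≢ a × (a ≢ q → ¬ y ~ a)
      R-chain′ ry (inj₁ (h , a∈)) with proj₁ (route-in h a∈)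
      ... | inj₁ da = let p , q = R-D ry da in p , λ _ → q
      ... | inj₂ (xa , _) = let p , q = R-X ry xa in p , λ _ → q
      R-chain′ ry (inj₂ a∈) = R-chain ry a∈
      -- Outside both balls the old neighbour `x` of `w` survives. If `x` or its partner `p` came
      -- too close to `z`, or `x` saw a neighbour of `z`, then `w` would be within distance 3 of
      -- `z`; likewise for `z′`. The low part of the tree is excluded by `height`.
      keep : ∀ w → (E w × ¬ Near z w) × ¬ Near z′ w → E w × ∃ λ x → X′ x × x ~ w
      keep w ((e , ¬nz) , ¬nz′) with proj₂ (proj₁ (A⊆A₁ (E⊆A e)))
      ... | x , xx , xw with X-P xx
      ...   | p , pp , xp = e , x ,
        ( xx , (λ { refl → nz₁ xw }) , (λ { refl → nz′₁ xw }) , ¬xv , off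
        , p , (pp , ((λ { refl → nz₂ xp }) , λ e → nz₃ (~-sym e) xp)
                  , ((λ { refl → nz′₂ xp }) , λ e → nz′₃ (~-sym e) xp)) , xp ) , xw
        where
        nz₁ : ¬ z ~ w
        nz₁ e₁ = ¬nz (near 1 (s≤s z≤n) (edge e₁))
        nz′₁ : ¬ z′ ~ w
        nz′₁ e₁ = ¬nz′ (near 1 (s≤s z≤n) (edge e₁))
        nz₂ : ¬ x ~ z
        nz₂ e₁ = ¬nz (near 2 (s≤s (s≤s z≤n)) (_ , ~-sym e₁ , edge xw))
        nz′₂ : ¬ x ~ z′
        nz′₂ e₁ = ¬nz′ (near 2 (s≤s (s≤s z≤n)) (_ , ~-sym e₁ , edge xw))
        nz₃ : ∀ {y} → z ~ y → ¬ x ~ y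
        nz₃ e₁ e₂ = ¬nz (near 3 (s≤s (s≤s (s≤s z≤n))) (_ , e₁ , _ , ~-sym e₂ , edge xw))
        nz′₃ : ∀ {y} → z′ ~ y → ¬ x ~ y
        nz′₃ e₁ e₂ = ¬nz′ (near 3 (s≤s (s≤s (s≤s z≤n))) (_ , e₁ , _ , ~-sym e₂ , edge xw))
        ¬xv : ¬ x ~ v
        ¬xv xv = nz₃ zτ (subst (x ~_) (sym (τ-v (n≤0⇒n≡0 (subst (t ≤_) level-v (height e xx xw (inj₁ refl) xv))))) xv)
        off : ∀ y → Low y → y ≢ b → ¬ x ~ y
        off y (inj₁ (dy , lt)) _ xy = <⇒≱ lt (height e xx xw (inj₂ dy) xy)
        off y (inj₂ (here refl)) _ = nz₃ zτ
        off y (inj₂ (there (here refl))) _ = nz′₃ z′τ′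
        off y (inj₂ (there (there (here refl)))) _ = nz₂
        off y (inj₂ (there (there (there (here refl))))) _ = nz′₂
        off y (inj₂ (there (there (there (there (here refl)))))) _ = nz₃ zu
        off y (inj₂ (there (there (there (there (there (here refl))))))) _ = nz′₃ z′k
        off y (inj₂ (there (there (there (there (there (there (here refl)))))))) y≢b = contradiction refl y≢b

    atLevel : ∀ {B l} → Decidable B → (∀ {w} → B w → A₁ w) → (∀ {w} → B w → level w ≡ l) →
      ¬ Col B (cost c + cost c) → State q (suc i) c
    atLevel {B} {zero} B? B⊆A₁ lev ¬col with nonempty B? ¬col
    ... | w , bw = contradiction (near 0 z≤n (level⇒walk 0 (inj₂ (proj₁ (proj₁ (B⊆A₁ bw)))) (lev bw)))
          (proj₂ (B⊆A₁ bw))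
    atLevel {B} {suc zero} B? B⊆A₁ lev ¬col with nonempty B? ¬col
    ... | w , bw = contradiction (near 1 (s≤s z≤n) (level⇒walk 1 (inj₂ (proj₁ (proj₁ (B⊆A₁ bw)))) (lev bw)))
          (proj₂ (B⊆A₁ bw))
    atLevel {B} {suc (suc l″)} B? B⊆A₁ lev ¬col = viaClass (parityClass B? η ¬col)
      where
      open Target {l″} {B} B? (λ b → proj₁ (proj₁ (B⊆A₁ b))) lev
      viaClass : (Σ (V → Set) λ B′ → Decidable B′ × (∀ {w} → B′ w → B w) × ¬ Col B′ (cost c)
        × (∀ {u w} → B′ u → B′ w → SameParity (η u) (η w))) → State q (suc i) c
      viaClass (B′ , B′? , B′⊆B , ¬col′ , par) =
        finish B⊆A₁ (λ b le → <⇒≱ (s≤s (s≤s z≤n)) (subst (_≤ 1) (lev b) le))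
          (Class.link B′? B′⊆B par ¬col′)

    atParity : (Σ (V → Set) λ B → Decidable B × (∀ {w} → B w → A₁ w) × ¬ Col B (cost c + cost c)
      × (∀ {u w} → B u → B w → SameParity (level u) (level w))) → State q (suc i) c
    atParity (B , B? , B⊆A₁ , ¬col , par) = viaClass (bigClass B? level same ¬col)
      where
      B⊆D : ∀ {w} → B w → D w
      B⊆D b = proj₁ (proj₁ (B⊆A₁ b))
      same : ∀ u w → B u → B w → u ~ w → level u ≡ level w
      same u w bu bw e = sameParity⇒≡ (par bu bw)
        (level-≤ (inj₂ (B⊆D bw)) (B⊆D bu) (~-sym e)) (level-≤ (inj₂ (B⊆D bu)) (B⊆D bw) e)
      viaClass : (∃ λ a → B a × ¬ Col (λ u → B u × level u ≡ level a) (cost c + cost c)) → State q (suc i) c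
      viaClass (a , _ , ¬col′) =
        atLevel (λ u → B? u ×-dec (level u ≟ level a)) (λ b → B⊆A₁ (proj₁ b)) proj₂ ¬col′

-- The initial state.

-- The outer 2 pays for the ball around `z₀`, and the sum for fixing the parity of the level. In
-- each summand one 2 pays for the neighbours of `x₀` and the other for the ball around `x₀`.
seed : ℕ → ℕ
seed c = 2 + ((2 + (2 + c)) + (2 + (2 + c)))

module Initial (G : Graph) (og : OddGirth≥ G 11) (Y : Fin (n G) → Set) (Y? : Decidable Y) where
  open Chains G og Y public

  -- The return path is taken from the first search tree. `D`, `X` and `P` lie on levels `3 + k`,
  -- `2 + k` and `1 + k`; `R` consists of the levels up to `k` together with `p₀` and `x₀`, through
  -- which it descends to `q`, a neighbour of `x₀`. So `X` must stay clear of `x₀` and `p₀`: a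
  -- vertex whose parent sees either one is within distance 3 of `x₀`, and one ball suffices.
  initial : ∀ {c} → ¬ Col Y (seed c) → ∃ λ q → State q 0 c
  initial {c} ¬colY = rooted (bigComponent Y? ¬colY)
    where
    rooted : (∃ λ z₀ → Y z₀ × ¬ Col (Reach Y z₀) (seed c)) → ∃ λ q → State q 0 c
    rooted (z₀ , Yz₀ , ¬colC) =
      atParity (parityClass A₁? level (remove (near? z₀) (col-mono (λ _ → proj₂) ≤-refl (near-col z₀)) ¬colC))
      where
      C : V → Set
      C = Reach Y z₀
      D₀ : V → Set
      D₀ w = C w × w ≢ z₀
      D₀? : Decidable D₀
      D₀? w = reach? Y? z₀ w ×-dec ¬? (w ≟ᶠ z₀)
      reach₀ : ∀ {w} → C w → Reach D₀ z₀ w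
      reach₀ here = here
      reach₀ (step {u} {w} r yw e) with w ≟ᶠ z₀
      -- A walk that returns to `z₀` is restarted there, since `D₀` excludes `z₀`.
      ... | yes refl = here
      ... | no w≢z₀ = step (reach₀ r) (step r yw e , w≢z₀) e
      open Levels D₀? z₀ (λ d → proj₂ d refl) (λ d → reach₀ (proj₁ d))

      A₁ : V → Set
      A₁ w = C w × ¬ Near z₀ w
      A₁? : Decidable A₁
      A₁? w = reach? Y? z₀ w ×-dec ¬? (near? z₀ w)
      A₁⊆D₀ : ∀ {w} → A₁ w → D₀ w
      A₁⊆D₀ (cw , ¬near) = cw , λ { refl → ¬near (near 0 z≤n refl) }

      D₀⊆Y : ∀ {w} → D₀ w → Y w
      D₀⊆Y (cw , _) = reach-in Yz₀ cw
      D⁺⊆Y : ∀ {w} → D⁺ w → Y w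
      D⁺⊆Y (inj₁ refl) = Yz₀
      D⁺⊆Y (inj₂ d) = D₀⊆Y d

      level-apart : ∀ {y w} → D⁺ y → D₀ w → suc (suc (level y)) ≤ level w → Apart y w
      level-apart dy dw le = (λ { refl → <⇒≱ (≤-trans (n≤1+n _) le) ≤-refl }) , λ e → <⇒≱ le (level-≤ dy dw e)

      inD₀ : ∀ {w j} → D⁺ w → level w ≡ suc j → D₀ w
      inD₀ (inj₁ refl) eq = contradiction (trans (sym level-v) eq) λ ()
      inD₀ (inj₂ d) _ = d

      parentAt : ∀ {w j} → D₀ w → level w ≡ suc j → ∃ λ u → D⁺ u × u ~ w × level u ≡ j
      parentAt dw eq with parent dw
      ... | u , du , e , eq′ = u , du , e , suc-injective (trans (sym eq′) eq)

      atLevel : ∀ {A k} → Decidable A → (∀ {w} → A w → A₁ w) → (∀ {w} → A w → level w ≡ 3 + k) →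
        ¬ Col A (2 + (2 + c)) → ∃ λ q → State q 0 c
      atLevel {A} {k} A? A⊆A₁ lev ¬colA = inD₁ (bigComponent A? ¬colA)
        where
        A⊆D₀ : ∀ {w} → A w → D₀ w
        A⊆D₀ a = A₁⊆D₀ (A⊆A₁ a)
        inD₁ : (∃ λ d₀ → A d₀ × ¬ Col (Reach A d₀) (2 + (2 + c))) → ∃ λ q → State q 0 c
        inD₁ (d₀ , ad₀ , ¬colD₁) with parentAt (A⊆D₀ ad₀) (lev ad₀)
        ... | x₀ , dx₀ , x₀d₀ , lx₀ with parentAt (inD₀ dx₀ lx₀) lx₀
        ...   | p₀ , dp₀ , p₀x₀ , lp₀ with parentAt (inD₀ dp₀ lp₀) lp₀
        ...     | r₀ , dr₀ , r₀p₀ , lr₀ =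
          inE (bigComponent F₁? (remove (x₀ ~?_) (neighbours-col x₀) ¬colD₁))
          where
          F₁ : V → Set
          F₁ w = Reach A d₀ w × ¬ x₀ ~ w
          F₁? : Decidable F₁
          F₁? w = reach? A? d₀ w ×-dec ¬? (x₀ ~? w)
          F₁⊆A : ∀ {w} → F₁ w → A w
          F₁⊆A f = reach-in ad₀ (proj₁ f)
          inE : (∃ λ e₀ → F₁ e₀ × ¬ Col (Reach F₁ e₀) (2 + c)) → ∃ λ q → State q 0 c
          inE (e₀ , fe₀ , ¬colE) =
            atQ (exit (reach? F₁? e₀) (reach-sym ad₀ (proj₁ fe₀)) here λ ed₀ → proj₂ (reach-in fe₀ ed₀) x₀d₀)
            where
            E : V → Set
            E = Reach F₁ e₀
            E⊆A : ∀ {w} → E w → A w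
            E⊆A e = F₁⊆A (reach-in fe₀ e)
            E⊆D₀ : ∀ {w} → E w → D₀ w
            E⊆D₀ e = A⊆D₀ (E⊆A e)
            levE : ∀ {w} → E w → level w ≡ 3 + k
            levE e = lev (E⊆A e)
            P X R : V → Set
            P p = D⁺ p × level p ≡ 1 + k
            X x = D₀ x × level x ≡ 2 + k × x ≢ x₀ × ¬ x ~ x₀ × ¬ x ~ p₀
            R y = (D⁺ y × level y ≤ k) ⊎ y ≡ p₀ ⊎ y ≡ x₀
            below : ∀ {y w i j} → D⁺ y → D₀ w → level y ≤ i → level w ≡ j → suc (suc i) ≤ j → Apart y w
            below dy dw ly refl le = level-apart dy dw (≤-trans (s≤s (s≤s ly)) le)
            differ : ∀ {y w i j} → level y ≡ i → level w ≡ j → i ≢ j → y ≢ w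
            differ ly lw i≢j refl = i≢j (trans (sym ly) lw)

            keep : ∀ w → E w × ¬ Near x₀ w → E w × ∃ λ x → X x × x ~ w
            keep w (e , ¬near) with parentAt (E⊆D₀ e) (levE e)
            ... | x , dx , xw , lx = e , x ,
              ( inD₀ dx lx , lx , (λ { refl → proj₂ (reach-in fe₀ e) xw })
              , (λ xx₀ → ¬near (near 2 (s≤s (s≤s z≤n)) (_ , ~-sym xx₀ , edge xw)))
              , (λ xp₀ → ¬near (near 3 (s≤s (s≤s (s≤s z≤n))) (_ , ~-sym p₀x₀ , _ , ~-sym xp₀ , edge xw))) ) , xw

            Rz₀ : R z₀
            Rz₀ = inj₁ (inj₁ refl , subst (_≤ k) (sym level-v) z≤n)
            fromRoot : ∀ j {w} → D⁺ w → level w ≡ j → j ≤ k → Reach R z₀ w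
            fromRoot zero dw eq _ = subst (Reach R z₀) (sym (level0⇒v dw eq)) here
            fromRoot (suc j) dw eq le with parentAt (inD₀ dw eq) eq
            ... | u , du , e , lu =
              step (fromRoot j du lu (≤-trans (n≤1+n j) le)) (inj₁ (dw , subst (_≤ k) (sym eq) le)) e

            atQ : (∃ λ e → ∃ λ q → E e × Reach A e₀ q × A q × ¬ E q × e ~ q) → ∃ λ q → State q 0 c
            atQ (e , q , Ee , rq , Aq , ¬Eq , eq) = q , record
              { chain = start
              ; D = E ; X = X ; P = P ; R = R
              ; D? = reach? F₁? e₀
              ; X? = λ x → D₀? x ×-dec (level x ≟ 2 + k) ×-dec ¬? (x ≟ᶠ x₀) ×-dec ¬? (x ~? x₀) ×-dec ¬? (x ~? p₀)
              ; P? = λ p → D⁺? p ×-dec (level p ≟ 1 + k)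
              ; reach = λ d → reach-trans
                  (reach-trans (step here Ee (~-sym eq)) (reach-sym here (reach-self Ee))) (reach-self d)
              ; D-chain = λ { d refl → (λ { refl → ¬Eq d }) , λ q≢q → contradiction refl q≢q }
              ; X-chain = λ { (_ , lx , _) refl → differ lx (lev Aq) (λ ()) , λ q≢q → contradiction refl q≢q }
              ; X∩D = λ { (_ , lx , _) d → differ lx (levE d) (λ ()) refl }
              ; P-chain = λ { (dp , lp) refl → below dp (A⊆D₀ Aq) (≤-reflexive lp) (lev Aq) ≤-refl }
              ; P-D = λ (dp , lp) d → below dp (E⊆D₀ d) (≤-reflexive lp) (levE d) ≤-refl
              ; X-P = λ (dx , lx , _) → let p , dp , e , lp = parentAt dx lx in p , (dp , lp) , ~-sym e
              ; R-chain = λ { r refl → R≢q r , λ q≢q → contradiction refl q≢q }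
              ; R-D = R-D
              ; R-X = R-X
              ; P-R = λ (dp , lp) → let y , dy , e , ly = parentAt (inD₀ dp lp) lp in
                  y , inj₁ (dy , ≤-reflexive ly) , ~-sym e
              ; R-q = R-q
              ; far = λ { (here refl) q≢q _ → contradiction refl q≢q }
              ; big = λ col → remove (near? x₀) (col-mono (λ _ → proj₂) ≤-refl (near-col x₀)) ¬colE
                  (col-mono keep ≤-refl col)
              ; q∈Y = D₀⊆Y (A⊆D₀ Aq)
              ; D⊆Y = λ d → D₀⊆Y (E⊆D₀ d)
              ; X⊆Y = λ x → D₀⊆Y (proj₁ x)
              ; P⊆Y = λ p → D⁺⊆Y (proj₁ p)
              ; R⊆Y = λ { (inj₁ (dy , _)) → D⁺⊆Y dy ; (inj₂ (inj₁ refl)) → D⁺⊆Y dp₀ ; (inj₂ (inj₂ refl)) → D⁺⊆Y dx₀ }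
              }
              where
              R≢q : ∀ {y} → R y → y ≢ q
              R≢q (inj₁ (dy , le)) = proj₁ (below dy (A⊆D₀ Aq) le (lev Aq) (n≤1+n _))
              R≢q (inj₂ (inj₁ refl)) = differ lp₀ (lev Aq) λ ()
              R≢q (inj₂ (inj₂ refl)) = differ lx₀ (lev Aq) λ ()
              R-D : ∀ {y d} → R y → E d → Apart y d
              R-D (inj₁ (dy , le)) d = below dy (E⊆D₀ d) le (levE d) (n≤1+n _)
              R-D (inj₂ (inj₁ refl)) d = below dp₀ (E⊆D₀ d) (≤-reflexive lp₀) (levE d) ≤-refl
              R-D (inj₂ (inj₂ refl)) d = differ lx₀ (levE d) (λ ()) , proj₂ (reach-in fe₀ d)
              R-X : ∀ {y x} → R y → X x → Apart y x
              R-X (inj₁ (dy , le)) (dx , lx , _) = below dy dx le lx ≤-refl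
              R-X (inj₂ (inj₁ refl)) (_ , lx , _ , _ , ¬xp₀) = differ lp₀ lx (λ ()) , λ e → ¬xp₀ (~-sym e)
              R-X (inj₂ (inj₂ refl)) (_ , _ , x≢x₀ , ¬xx₀ , _) = (λ eq → x≢x₀ (sym eq)) , λ e → ¬xx₀ (~-sym e)
              x₀q : x₀ ~ q
              x₀q = decidable-stable (x₀ ~? q) λ ¬x₀q → ¬Eq (step Ee (reach-trans (proj₁ fe₀) rq , ¬x₀q) eq)
              to-x₀ : Reach R q x₀
              to-x₀ = step here (inj₂ (inj₂ refl)) (~-sym x₀q)
              to-p₀ : Reach R q p₀
              to-p₀ = step to-x₀ (inj₂ (inj₁ refl)) (~-sym p₀x₀)
              to-z₀ : Reach R q z₀
              to-z₀ = reach-trans (step to-p₀ (inj₁ (dr₀ , ≤-reflexive lr₀)) (~-sym r₀p₀))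
                (reach-sym Rz₀ (fromRoot k dr₀ lr₀ ≤-refl))
              R-q : ∀ {y} → R y → Reach R q y
              R-q (inj₁ (dy , le)) = reach-trans to-z₀ (fromRoot _ dy refl le)
              R-q (inj₂ (inj₁ refl)) = to-p₀
              R-q (inj₂ (inj₂ refl)) = to-x₀

      atParity : (Σ (V → Set) λ B → Decidable B × (∀ {w} → B w → A₁ w) × ¬ Col B (2 + (2 + c))
        × (∀ {u w} → B u → B w → SameParity (level u) (level w))) → ∃ λ q → State q 0 c
      atParity (B , B? , B⊆A₁ , ¬col , par) = viaClass (bigClass B? level same ¬col)
        where
        B⊆D₀ : ∀ {w} → B w → D₀ w
        B⊆D₀ b = A₁⊆D₀ (B⊆A₁ b)
        same : ∀ u w → B u → B w → u ~ w → level u ≡ level w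
        same u w bu bw e = sameParity⇒≡ (par bu bw)
          (level-≤ (inj₂ (B⊆D₀ bw)) (B⊆D₀ bu) (~-sym e)) (level-≤ (inj₂ (B⊆D₀ bu)) (B⊆D₀ bw) e)
        viaClass : (∃ λ a → B a × ¬ Col (λ u → B u × level u ≡ level a) (2 + (2 + c))) → ∃ λ q → State q 0 c
        viaClass (a , ba , ¬col′) =
          atLevel (λ u → B? u ×-dec (level u ≟ level a)) (λ b → B⊆A₁ (proj₁ b))
            (λ b → trans (proj₂ b) (sym (m+[n∸m]≡n deep))) ¬col′
          where
          -- Room for the three ancestors `x₀`, `p₀`, `r₀`, secured by the deleted ball around `z₀`.
          deep : 3 ≤ level a
          deep = ≮⇒≥ λ lt → proj₂ (B⊆A₁ ba) (near (level a) (≤-trans (<⇒≤ lt) (m≤m+n 3 1)) (level⇒walk _ (inj₂ (B⊆D₀ ba)) refl))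

-- Consecutive pairs and positions in lists.

module _ {A : Set} where

  edges-left : ∀ xs {y zs} {u w : A} → Edges (xs ++ y ∷ []) u w → Edges (xs ++ y ∷ zs) u w
  edges-left [] (there ())
  edges-left (x ∷ []) here = here
  edges-left (x ∷ []) (there (there ()))
  edges-left (x ∷ x′ ∷ xs) here = here
  edges-left (x ∷ x′ ∷ xs) (there i) = there (edges-left (x′ ∷ xs) i)

  edges-right : ∀ xs {zs} {u w : A} → Edges zs u w → Edges (xs ++ zs) u w
  edges-right [] i = i
  edges-right (x ∷ xs) i = there (edges-right xs i)

  edges-split : ∀ xs {y zs} {u w : A} → Edges (xs ++ y ∷ zs) u w →
    Edges (xs ++ y ∷ []) u w ⊎ Edges (y ∷ zs) u w
  edges-split [] i = inj₂ i
  edges-split (x ∷ []) here = inj₁ here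
  edges-split (x ∷ []) (there i) = inj₂ i
  edges-split (x ∷ x′ ∷ xs) here = inj₁ here
  edges-split (x ∷ x′ ∷ xs) (there i) = [ (λ j → inj₁ (there j)) , inj₂ ]′ (edges-split (x′ ∷ xs) i)

  endsAt-++ : ∀ xs {l} {e : A} → EndsAt l e → EndsAt (xs ++ l) e
  endsAt-++ [] en = en
  endsAt-++ (x ∷ xs) en = more (endsAt-++ xs en)

  endsAt-init : ∀ {l} {e : A} → EndsAt l e → ∃ λ xs → l ≡ xs ++ e ∷ []
  endsAt-init end = [] , refl
  endsAt-init (more en) with endsAt-init en
  ... | xs , refl = _ ∷ xs , refl

  endsAt-∈ : ∀ {l} {e : A} → EndsAt l e → e ∈ˡ l
  endsAt-∈ end = here refl
  endsAt-∈ (more en) = there (endsAt-∈ en)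

  unique-init≢last : ∀ xs {e y : A} → Unique (xs ++ e ∷ []) → y ∈ˡ xs → y ≢ e
  unique-init≢last (x ∷ xs) (p ∷ _) (here refl) = All.lookup p (∈-++⁺ʳ xs (here refl))
  unique-init≢last (x ∷ xs) (_ ∷ p) (there i) = unique-init≢last xs p i

  lookup-injective : ∀ {l : List A} → Unique l → ∀ {i j} → lookup l i ≡ lookup l j → i ≡ j
  lookup-injective {x ∷ l} (p ∷ _) {zero} {zero} _ = refl
  lookup-injective {x ∷ l} (p ∷ _) {zero} {suc j} eq = contradiction eq (All.lookup p (∈-lookup j))
  lookup-injective {x ∷ l} (p ∷ _) {suc i} {zero} eq = contradiction (sym eq) (All.lookup p (∈-lookup i))
  lookup-injective {x ∷ l} (_ ∷ p) {suc i} {suc j} eq = cong suc (lookup-injective p eq)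

  lookup-last : ∀ {a s} {e : A} → EndsAt (a ∷ s) e → lookup (a ∷ s) (fromℕ (length s)) ≡ e
  lookup-last end = refl
  lookup-last {s = _ ∷ _} (more en) = lookup-last en

  edges⇒lookup : ∀ {a s} {u w : A} → Edges (a ∷ s) u w →
    ∃ λ (i : Fin (length s)) → lookup (a ∷ s) (inject₁ i) ≡ u × lookup s i ≡ w
  edges⇒lookup here = zero , refl , refl
  edges⇒lookup {s = _ ∷ _} (there e) with edges⇒lookup e
  ... | i , p , q = suc i , p , q

  lookup⇒edges : ∀ {a} s (i : Fin (length s)) → Edges {A} (a ∷ s) (lookup (a ∷ s) (inject₁ i)) (lookup s i)
  lookup⇒edges (b ∷ s) zero = here
  lookup⇒edges (b ∷ s) (suc i) = there (lookup⇒edges s i)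

cnext-last : ∀ m → cnext (fromℕ m) ≡ zero
cnext-last m = toℕ-injective (trans (toℕ-fromℕ< (m%n<n (suc (toℕ (fromℕ m))) (suc m)))
  (trans (cong (λ x → suc x % suc m) (toℕ-fromℕ m)) (n%n≡0 (suc m))))

cnext-inject₁ : ∀ {m} (i : Fin m) → cnext (inject₁ i) ≡ suc i
cnext-inject₁ {m} i = toℕ-injective (trans (toℕ-fromℕ< (m%n<n (suc (toℕ (inject₁ i))) (suc m)))
  (trans (cong (λ x → suc x % suc m) (toℕ-inject₁ i)) (m<n⇒m%n≡m (s≤s (toℕ<n i)))))

allPairs-lookup : ∀ {A : Set} {R : A → A → Set} → (∀ {a b} → R a b → R b a) → ∀ {l} → AllPairs R l →
  ∀ i j → i ≢ j → R (lookup l i) (lookup l j)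
allPairs-lookup s (p ∷ ps) zero zero i≢j = contradiction refl i≢j
allPairs-lookup s (p ∷ ps) zero (suc j) _ = All.lookup p (∈-lookup j)
allPairs-lookup s (p ∷ ps) (suc i) zero _ = s (All.lookup p (∈-lookup i))
allPairs-lookup s (p ∷ ps) (suc i) (suc j) i≢j = allPairs-lookup s ps i j λ { refl → i≢j refl }

-- From vertex lists to the rope.

module Ropes (G : Graph) (og : OddGirth≥ G 11) (Y : Fin (n G) → Set) (Y? : Decidable Y) where
  open Initial G og Y Y? public

  -- Prepending the last vertex `e` makes the closing edge an ordinary consecutive pair. This is why
  -- the cycle below is accompanied by its last vertex `base`.
  cyclic-edges : ∀ {a : V} {s e} → EndsAt (a ∷ s) e → ∀ {u w} →
    Edges (e ∷ a ∷ s) u w ⇔ (∃ λ i → lookup (a ∷ s) i ≡ u × lookup (a ∷ s) (cnext i) ≡ w)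
  cyclic-edges {a} {s} {e} en = mk⇔ to from
    where
    to : ∀ {u w} → Edges (e ∷ a ∷ s) u w → ∃ λ i → lookup (a ∷ s) i ≡ u × lookup (a ∷ s) (cnext i) ≡ w
    to here = fromℕ (length s) , lookup-last en , cong (lookup (a ∷ s)) (cnext-last (length s))
    to (there ed) with edges⇒lookup ed
    ... | i , p , q = inject₁ i , p , trans (cong (lookup (a ∷ s)) (cnext-inject₁ i)) q
    from : ∀ {u w} → (∃ λ i → lookup (a ∷ s) i ≡ u × lookup (a ∷ s) (cnext i) ≡ w) → Edges (e ∷ a ∷ s) u w
    from (i , p , q) with view i
    ... | ‵fromℕ = subst₂ (Edges _) (trans (sym (lookup-last en)) p)
            (trans (cong (lookup (a ∷ s)) (sym (cnext-last (length s)))) q) here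
    ... | ‵inject₁ j = there (subst₂ (Edges _) p
            (trans (cong (lookup (a ∷ s)) (sym (cnext-inject₁ j))) q) (lookup⇒edges s j))

  induced⇒path : ∀ {a s e} → Induced (a ∷ s) → EndsAt (a ∷ s) e →
    IsPathBetween G (length s) (lookup (a ∷ s)) a e
  induced⇒path {a} {s} p en =
    record { distinct = lookup-injective (induced-unique p)
           ; steps = λ i → induced-edge p (lookup⇒edges s i) }
    , refl , lookup-last en

  record RopeLists : Set where
    field
      q : Fin 5 → V
      tail : Fin 5 → Fin 2 → List V
    seg : Fin 5 → Fin 2 → List V
    seg i h = q i ∷ tail i h
    field
      seg-induced : ∀ i h → Induced (seg i h)
      seg-end : ∀ i h → EndsAt (seg i h) (q (cnext i))
      seg-odd : ∀ i → Odd (length (tail i zero))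
      seg-even : ∀ i → Even (length (tail i (suc zero)))
      seg-in : ∀ i h {y} → y ∈ˡ seg i h → Y y
      cycle : (Fin 5 → Fin 2) → List V
      base : V
      cycle-end : ∀ hs → EndsAt (cycle hs) base
      cycle-unique : ∀ hs → Unique (cycle hs)
      cycle-long : ∀ hs → 3 ≤ length (cycle hs)
      vertices : ∀ hs {y} → (∃ λ i → y ∈ˡ seg i (hs i)) ⇔ y ∈ˡ cycle hs
      edges : ∀ hs {u w} → (∃ λ i → Edges (seg i (hs i)) u w) ⇔ Edges (base ∷ cycle hs) u w
      cycle-adj : ∀ hs {u w} → u ∈ˡ cycle hs → w ∈ˡ cycle hs → u ~ w →
        Edges (base ∷ cycle hs) u w ⊎ Edges (base ∷ cycle hs) w u
      far : ∀ i j → i ≢ j → ¬ Near (q i) (q j)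

  path⇒walk : ∀ {ℓ p a b} → IsPathBetween G ℓ p a b → Walk ℓ a b
  path⇒walk {zero} (_ , refl , refl) = refl
  path⇒walk {suc ℓ} {p} (isP , refl , refl) = p (suc zero) , IsPath.steps isP zero ,
    path⇒walk {ℓ} {λ i → p (suc i)}
      (record { distinct = λ eq → sucᶠ-injective (IsPath.distinct isP eq)
              ; steps = λ i → IsPath.steps isP (suc i) } , refl , refl)

  rope : (X : Subset (n G)) → (∀ {y} → Y y → y ∈ X) → RopeLists → ArithRope5 G X
  rope X Y⊆X L = record
    { q = q
    ; q∈X = λ i → Y⊆X (seg-in i zero (here refl))
    ; len = λ i h → length (tail i h)
    ; Q = Q
    ; Q-path = λ i h → induced⇒path (seg-induced i h) (seg-end i h)
    ; Q-in-X = λ i h j → Y⊆X (seg-in i h (∈-lookup j))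
    ; Q-odd = seg-odd
    ; Q-even = seg-even
    ; induced = induced
    ; far = λ i j i≢j ℓ ℓ<5 p isP → far i j i≢j (near ℓ (≤-pred ℓ<5) (path⇒walk isP))
    }
    where
    open RopeLists L
    Q : ∀ i h → Fin (suc (length (tail i h))) → V
    Q i h = lookup (seg i h)
    open Equivalence
    induced : ∀ hs → IsInducedCycle G
      (λ y → ∃ λ i → VertexOfPath (Q i (hs i)) y)
      (λ u w → ∃ λ i → EdgeOfPath (Q i (hs i)) u w)
    induced hs = onList (cycle hs) (cycle-end hs) (cycle-unique hs) (cycle-long hs) (vertices hs) (edges hs) (cycle-adj hs)
      where
      onPath : ∀ {y} → (∃ λ i → VertexOfPath (Q i (hs i)) y) → ∃ λ i → y ∈ˡ seg i (hs i)
      onPath (i , j , eq) = i , subst (_∈ˡ seg i (hs i)) eq (∈-lookup j)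
      fromPath : ∀ {y} → (∃ λ i → y ∈ˡ seg i (hs i)) → ∃ λ i → VertexOfPath (Q i (hs i)) y
      fromPath (i , y∈) = i , Any.index y∈ , sym (Any.lookup-index y∈)
      toEdge : ∀ {u w} → (∃ λ i → EdgeOfPath (Q i (hs i)) u w) →
        (∃ λ i → Edges (seg i (hs i)) u w) ⊎ (∃ λ i → Edges (seg i (hs i)) w u)
      toEdge (i , j , inj₁ (p , r)) = inj₁ (i , subst₂ (Edges (seg i (hs i))) p r (lookup⇒edges (tail i (hs i)) j))
      toEdge (i , j , inj₂ (p , r)) = inj₂ (i , subst₂ (Edges (seg i (hs i))) p r (lookup⇒edges (tail i (hs i)) j))
      fromEdge₁ : ∀ {u w} → (∃ λ i → Edges (seg i (hs i)) u w) → ∃ λ i → EdgeOfPath (Q i (hs i)) u w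
      fromEdge₁ (i , e) with edges⇒lookup e
      ... | j , p , r = i , j , inj₁ (p , r)
      fromEdge₂ : ∀ {u w} → (∃ λ i → Edges (seg i (hs i)) w u) → ∃ λ i → EdgeOfPath (Q i (hs i)) u w
      fromEdge₂ (i , e) with edges⇒lookup e
      ... | j , p , r = i , j , inj₂ (p , r)
      -- `cycle hs` is generalised to a variable so that it can be matched as a head and a tail.
      onList : ∀ l → EndsAt l base → Unique l → 3 ≤ length l →
        (∀ {y} → (∃ λ i → y ∈ˡ seg i (hs i)) ⇔ y ∈ˡ l) →
        (∀ {u w} → (∃ λ i → Edges (seg i (hs i)) u w) ⇔ Edges (base ∷ l) u w) →
        (∀ {u w} → u ∈ˡ l → w ∈ˡ l → u ~ w → Edges (base ∷ l) u w ⊎ Edges (base ∷ l) w u) →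
        IsInducedCycle G
          (λ y → ∃ λ i → VertexOfPath (Q i (hs i)) y)
          (λ u w → ∃ λ i → EdgeOfPath (Q i (hs i)) u w)
      onList (a ∷ s) en uq (s≤s long) vs es adj =
        (length s , lookup (a ∷ s) , long , lookup-injective uq
        , (λ y → mk⇔
            (λ p → let i = to vs (onPath p) in Any.index i , sym (Any.lookup-index i))
            (λ { (i , refl) → fromPath (from vs (∈-lookup i)) }))
        , λ u w → mk⇔
            (λ p → [ (λ e → let i , x , y = to (cyclic-edges en) (to es e) in i , inj₁ (x , y))
                   , (λ e → let i , x , y = to (cyclic-edges en) (to es e) in i , inj₂ (x , y)) ]′ (toEdge p))
            (λ { (i , inj₁ x) → fromEdge₁ (from es (from (cyclic-edges en) (i , x)))
               ; (i , inj₂ x) → fromEdge₂ (from es (from (cyclic-edges en) (i , x))) }))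
        , λ u w pu pw uw →
            [ (λ e → fromEdge₁ (from es e)) , (λ e → fromEdge₂ (from es e)) ]′
              (adj (to vs (onPath pu)) (to vs (onPath pw)) uw)

-- Closing the chain and reading off the rope.

module Assembly (G : Graph) (og : OddGirth≥ G 11) (Y : Fin (n G) → Set) (Y? : Decidable Y) where
  open Ropes G og Y Y? public

  near-sym : ∀ {a b} → Near a b → Near b a
  near-sym (k , w) = k , revʷ w

  chain-start : ∀ {q i v} (c : Chain q i v) → OnChain c q
  chain-start start = refl
  chain-start (extend c _ _ _ _ _ _ _ _) = inj₂ (chain-start c)

  chain-ends≢ : ∀ {q i v} → Chain q (suc i) v → q ≢ v
  chain-ends≢ (extend c route hd _ _ _ fresh _ _) with hd zero
  ... | s , eq = λ q≡v → proj₁ (fresh zero (subst (_ ∈ˡ_) (sym eq) (here refl)) (chain-start c)) (sym q≡v)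

  joints-far : ∀ {q i v} (c : Chain q i v) → AllPairs (λ b a → ¬ Near a b) (joints c)
  joints-far start = [] ∷ []
  joints-far (extend c _ _ _ _ _ _ far _) = All.tabulate far ∷ joints-far c

  module _ (hs : ℕ → Fin 2) where

    path : ∀ {q i v} → Chain q i v → List V
    path {q} start = q ∷ []
    path (extend {i} c route _ _ _ _ _ _ _) = route (hs i) ++ path c

    path-on : ∀ {q i v} (c : Chain q i v) {y} → y ∈ˡ path c → OnChain c y
    path-on start (here refl) = refl
    path-on (extend {i} c route _ _ _ _ _ _ _) y∈ =
      [ (λ j → inj₁ (hs i , j)) , (λ j → inj₂ (path-on c j)) ]′ (∈-++⁻ (route (hs i)) y∈)

    path-end : ∀ {q i v} (c : Chain q i v) → EndsAt (path c) q
    path-end start = end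
    path-end (extend c route _ _ _ _ _ _ _) = endsAt-++ (route _) (path-end c)

    path-long : ∀ {q i v} (c : Chain q i v) → suc i ≤ length (path c)
    path-long start = s≤s z≤n
    path-long (extend {i} c route hd _ _ _ _ _ _) with hd (hs i)
    ... | s , eq = subst (suc (suc i) ≤_) (sym (length-++ (route (hs i))))
      (subst (λ r → suc (suc i) ≤ length r + length (path c)) (sym eq)
        (s≤s (≤-trans (path-long c) (m≤n+m _ (length s)))))

    path-head : ∀ {q i v} (c : Chain q i v) → ∃ λ s → path c ≡ v ∷ s
    path-head start = [] , refl
    path-head (extend {i} c route hd _ _ _ _ _ _) =
      proj₁ (hd (hs i)) ++ path c , cong (_++ path c) (proj₂ (hd (hs i)))

    path-induced : ∀ {q i v} (c : Chain q i v) → Induced (path c)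
    path-induced start = sing
    path-induced (extend {i} {v} c route hd ind _ _ fresh _ _) =
      subst (λ l → Induced (route (hs i) ++ l)) (sym eq)
        (glue (route (hs i)) (ind (hs i)) pvs λ y∈ a∈ →
          -- `fresh` permits contact with `v` only, and `v` does not occur again further down the
          -- path.
          let p , r = fresh (hs i) y∈ (path-on c (subst (_ ∈ˡ_) (sym eq) (there a∈)))
          in p , r λ { refl → v∉ (induced-unique pvs) a∈ })
      where
      eq = proj₂ (path-head c)
      pvs : Induced (v ∷ proj₁ (path-head c))
      pvs = subst Induced eq (path-induced c)
      v∉ : ∀ {v s} → Unique (v ∷ s) → ¬ v ∈ˡ s
      v∉ (p ∷ _) v∈ = All.lookup p v∈ refl

  path-split : ∀ hs {q i v} (c : Chain q i v) xs {u w} →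
    Edges (xs ++ path hs c) u w → Edges (xs ++ v ∷ []) u w ⊎ Edges (path hs c) u w
  path-split hs c xs {u} {w} e with path-head hs c
  ... | s , eq with edges-split xs (subst (λ l → Edges (xs ++ l) u w) eq e)
  ...   | inj₁ x = inj₁ x
  ...   | inj₂ x = inj₂ (subst (λ l → Edges l u w) (sym eq) x)

  path-join : ∀ hs {q i v} (c : Chain q i v) xs {u w} →
    Edges (xs ++ v ∷ []) u w → Edges (xs ++ path hs c) u w
  path-join hs c xs {u} {w} e with path-head hs c
  ... | s , eq = subst (λ l → Edges (xs ++ l) u w) (sym eq) (edges-left xs e)

  record Closing {q i v} (c : Chain q i v) : Set where
    field
      inner : List V
      inner-induced : Induced (q ∷ inner ++ v ∷ [])
      inner-off : ∀ {y a} → y ∈ˡ inner → OnChain c a → y ≢ a × (a ≢ v → a ≢ q → ¬ y ~ a)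
      inner-in : ∀ {y} → y ∈ˡ inner → Y y

  -- With 0 colours, `big` still yields an edge between `D` and `X`, from which `X-P`, `P-R` and
  -- `R-q` lead to `q`. The union of the four sets meets no chain vertex and sees the chain only at
  -- `v` and `q`, so any induced path through it will do.
  closing : ∀ {q i} (S : State q (suc i) 0) → Closing (State.chain S)
  closing {q} S = fromReach toQ
    where
    open State S
    U M : V → Set
    U y = D y ⊎ X y ⊎ P y ⊎ R y
    -- `q` is added because `Reach` requires its target to lie in the set; `inU` removes it again by
    -- uniqueness.
    M y = U y ⊎ y ≡ q
    toQ : Reach M v q
    toQ with nonempty (λ w → D? w ×-dec any? λ x → X? x ×-dec (x ~? w)) big
    ... | d , dd , x , xx , xd with X-P xx
    ...   | p , pp , xp with P-R pp
    ...     | y , ry , py = reach-trans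
      (step (step (step (reach-mono (λ e → inj₁ (inj₁ e)) (reach dd)) (inj₁ (inj₂ (inj₁ xx))) (~-sym xd))
        (inj₁ (inj₂ (inj₂ (inj₁ pp)))) xp) (inj₁ (inj₂ (inj₂ (inj₂ ry)))) py)
      (reach-sym (inj₂ refl) (reach-mono (λ r → inj₁ (inj₂ (inj₂ (inj₂ r)))) (R-q ry)))
    U-off : ∀ {y a} → U y → OnChain chain a → y ≢ a × (a ≢ v → a ≢ q → ¬ y ~ a)
    U-off (inj₁ dy) a∈ = let e , f = D-chain dy a∈ in e , λ a≢v _ → f a≢v
    U-off (inj₂ (inj₁ xy)) a∈ = let e , f = X-chain xy a∈ in e , λ a≢v _ → f a≢v
    U-off (inj₂ (inj₂ (inj₁ py))) a∈ = let e , f = P-chain py a∈ in e , λ _ _ → f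
    U-off (inj₂ (inj₂ (inj₂ ry))) a∈ = let e , f = R-chain ry a∈ in e , λ _ a≢q → f a≢q
    U⊆Y : ∀ {y} → U y → Y y
    U⊆Y = [ D⊆Y , [ X⊆Y , [ P⊆Y , R⊆Y ]′ ]′ ]′
    fromReach : Reach M v q → Closing chain
    fromReach r with reach⇒induced r
    ... | [] , _ , end , _ = contradiction refl (chain-ends≢ chain)
    ... | l@(_ ∷ _) , ind , more en , inM with endsAt-init en
    ...   | inner , eq = record
      { inner = inner ; inner-induced = ind′
      ; inner-off = λ y∈ → U-off (inU y∈) ; inner-in = λ y∈ → U⊆Y (inU y∈) }
      where
      ind′ : Induced (q ∷ inner ++ v ∷ [])
      ind′ = subst (λ l → Induced (q ∷ l)) eq ind
      inU : ∀ {y} → y ∈ˡ inner → U y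
      inU y∈ with induced-unique ind′ | inM (subst (_ ∈ˡ_) (sym eq) (∈-++⁺ˡ y∈))
      ... | p ∷ _ | inj₁ (inj₂ refl) = contradiction refl (All.lookup p (∈-++⁺ˡ y∈))
      ... | _ ∷ p | inj₂ refl = contradiction refl (unique-init≢last inner p y∈)
      ... | _ | inj₁ (inj₁ u) = u

  flip₂ : Fin 2 → Fin 2
  flip₂ zero = suc zero
  flip₂ (suc zero) = zero

  adjust : ∀ (route : Fin 2 → List V) → Odd (length (route zero)) → Even (length (route (suc zero))) →
    ∀ k → ∃ λ (σ : Fin 2 → Fin 2) → Odd (k + length (route (σ zero))) × Even (k + length (route (σ (suc zero))))
  adjust route odd even k with even⊎odd k
  ... | inj₁ ek = (λ h → h) , even+odd ek odd , even+even ek even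
  ... | inj₂ ok = flip₂ , odd+even ok even , odd+odd ok odd

  -- The rope runs against the chain: q₀, b₄, b₃, b₂, b₁. Its first link is the closing path from q₀
  -- to v followed by the fifth link of the chain, with σ restoring the parity names.
  ropeLists : ∀ {q₀ v} (c : Chain q₀ 5 v) → Y q₀ → Closing c → RopeLists
  ropeLists {q₀}
    c₅@(extend c₄@(extend {v = b₃} c₃@(extend {v = b₂} c₂@(extend {v = b₁} c₁@(extend c₀@start
      r₁ hd₁ in₁ od₁ ev₁ fr₁ fa₁ y₁) r₂ hd₂ in₂ od₂ ev₂ fr₂ fa₂ y₂)
      r₃ hd₃ in₃ od₃ ev₃ fr₃ fa₃ y₃) {b₄} r₄ hd₄ in₄ od₄ ev₄ fr₄ fa₄ y₄)
      {v} r₅ hd₅ in₅ od₅ ev₅ fr₅ fa₅ y₅) Yq₀ cl = record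
    { q = q
    ; tail = tail
    ; seg-induced = seg-induced
    ; seg-end = seg-end
    ; seg-odd = seg-odd
    ; seg-even = seg-even
    ; seg-in = seg-in
    ; cycle = cycle
    ; base = q₀
    ; cycle-end = λ hs → endsAt-++ inner (path-end (turn hs) c₅)
    ; cycle-unique = cycle-unique
    ; cycle-long = cycle-long
    ; vertices = λ hs → mk⇔ (vertices⇒ hs) (vertices⇐ hs)
    ; edges = λ hs → mk⇔ (edges⇒ hs) (edges⇐ hs)
    ; cycle-adj = cycle-adj
    ; far = λ i j i≢j → allPairs-lookup {R = λ a b → ¬ Near a b} (λ f e → f (near-sym e))
        far i j i≢j
    }
    where
    open Closing cl
    ℓ : ℕ
    -- The number of edges of the closing path from `q₀` to `v`.
    ℓ = suc (length inner)
    σ : Fin 2 → Fin 2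
    σ = proj₁ (adjust r₅ od₅ ev₅ ℓ)

    corners : List V
    corners = q₀ ∷ b₄ ∷ b₃ ∷ b₂ ∷ b₁ ∷ []
    q : Fin 5 → V
    q = lookup corners
    far : AllPairs (λ a b → ¬ Near a b) corners
    far with joints-far c₄
    ... | (f₄₃ ∷ f₄₂ ∷ f₄₁ ∷ f₄₀ ∷ []) ∷ (f₃₂ ∷ f₃₁ ∷ f₃₀ ∷ []) ∷ (f₂₁ ∷ f₂₀ ∷ []) ∷ (f₁₀ ∷ []) ∷ [] ∷ [] =
      (f₄₀ ∷ f₃₀ ∷ f₂₀ ∷ f₁₀ ∷ [])
      ∷ (s f₄₃ ∷ s f₄₂ ∷ s f₄₁ ∷ []) ∷ (s f₃₂ ∷ s f₃₁ ∷ []) ∷ (s f₂₁ ∷ []) ∷ [] ∷ []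
      where
      s : ∀ {a b} → ¬ Near a b → ¬ Near b a
      s f e = f (near-sym e)

    tail : Fin 5 → Fin 2 → List V
    tail zero h = inner ++ r₅ (σ h) ++ b₄ ∷ []
    tail (suc zero) h = proj₁ (hd₄ h) ++ b₃ ∷ []
    tail (suc (suc zero)) h = proj₁ (hd₃ h) ++ b₂ ∷ []
    tail (suc (suc (suc zero))) h = proj₁ (hd₂ h) ++ b₁ ∷ []
    tail (suc (suc (suc (suc zero)))) h = proj₁ (hd₁ h) ++ q₀ ∷ []

    seg : Fin 5 → Fin 2 → List V
    seg i h = q i ∷ tail i h

    unfold : ∀ {b p} {route : Fin 2 → List V} (hd : ∀ h → ∃ λ s → route h ≡ b ∷ s) h →
      route h ++ p ∷ [] ≡ b ∷ (proj₁ (hd h) ++ p ∷ [])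
    unfold {p = p} hd h = cong (_++ p ∷ []) (proj₂ (hd h))

    seg-induced : ∀ i h → Induced (seg i h)
    -- Two separately built paths meet here. `inner` sees the chain only at `v` and `q₀`, and
    -- freshness of the last two links keeps `q₀` apart from the fifth route and from `b₄`.
    seg-induced zero h = subst (λ l → Induced ((q₀ ∷ inner) ++ l)) (sym (unfold hd₅ (σ h)))
      (glue (q₀ ∷ inner) inner-induced pr off)
      where
      pr : Induced (v ∷ (proj₁ (hd₅ (σ h)) ++ b₄ ∷ []))
      pr = subst Induced (unfold hd₅ (σ h)) (in₅ (σ h))
      rest-on : ∀ {a} → a ∈ˡ proj₁ (hd₅ (σ h)) ++ b₄ ∷ [] → a ≢ v × ((a ∈ˡ r₅ (σ h)) ⊎ (a ≡ b₄))
      rest-on {a} a∈ with induced-unique pr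
      ... | p ∷ _ = (λ eq → All.lookup p a∈ (sym eq)) ,
        [ (λ j → inj₁ (subst (a ∈ˡ_) (sym (proj₂ (hd₅ (σ h)))) (there j))) , (λ { (here eq) → inj₂ eq }) ]′
          (∈-++⁻ (proj₁ (hd₅ (σ h))) a∈)
      q₀≢b₄ : q₀ ≢ b₄
      q₀≢b₄ = chain-ends≢ c₄
      q₀-off : ∀ {a} → a ∈ˡ r₅ (σ h) ⊎ a ≡ b₄ → Apart q₀ a
      q₀-off (inj₁ a∈) = let e , f = fr₅ (σ h) a∈ (chain-start c₄) in
        (λ eq → e (sym eq)) , λ ad → f q₀≢b₄ (~-sym ad)
      q₀-off (inj₂ refl) = q₀≢b₄ , λ ad →
        proj₂ (fr₄ zero (subst (b₄ ∈ˡ_) (sym (proj₂ (hd₄ zero))) (here refl)) (chain-start c₃))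
          (chain-ends≢ c₃) (~-sym ad)
      on₅ : ∀ {a} → a ∈ˡ r₅ (σ h) ⊎ a ≡ b₄ → OnChain c₅ a
      on₅ (inj₁ a∈) = inj₁ (σ h , a∈)
      on₅ (inj₂ refl) = inj₂ (chain-end c₄)
      off : ∀ {y a} → y ∈ˡ q₀ ∷ inner → a ∈ˡ proj₁ (hd₅ (σ h)) ++ b₄ ∷ [] → Apart y a
      off (here refl) a∈ = q₀-off (proj₂ (rest-on a∈))
      off (there y∈) a∈ with rest-on a∈
      ... | a≢v , a∈′ = let e , f = inner-off y∈ (on₅ a∈′) in
        e , f a≢v (λ eq → proj₁ (q₀-off a∈′) (sym eq))
    seg-induced (suc zero) h = subst Induced (unfold hd₄ h) (in₄ h)
    seg-induced (suc (suc zero)) h = subst Induced (unfold hd₃ h) (in₃ h)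
    seg-induced (suc (suc (suc zero))) h = subst Induced (unfold hd₂ h) (in₂ h)
    seg-induced (suc (suc (suc (suc zero)))) h = subst Induced (unfold hd₁ h) (in₁ h)

    seg-end : ∀ i h → EndsAt (seg i h) (q (cnext i))
    seg-end zero h = more (endsAt-++ inner (endsAt-++ (r₅ (σ h)) end))
    seg-end (suc zero) h = more (endsAt-++ (proj₁ (hd₄ h)) end)
    seg-end (suc (suc zero)) h = more (endsAt-++ (proj₁ (hd₃ h)) end)
    seg-end (suc (suc (suc zero))) h = more (endsAt-++ (proj₁ (hd₂ h)) end)
    seg-end (suc (suc (suc (suc zero)))) h = more (endsAt-++ (proj₁ (hd₁ h)) end)

    len₀ : ∀ h → ℓ + length (r₅ (σ h)) ≡ length (tail zero h)
    len₀ h = sym (trans (length-++ inner)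
      (trans (cong (length inner +_) (trans (length-++ (r₅ (σ h))) (+-comm _ 1))) (+-suc (length inner) _)))
    len : ∀ {b p} {route : Fin 2 → List V} (hd : ∀ h → ∃ λ s → route h ≡ b ∷ s) h →
      length (route h) ≡ length (proj₁ (hd h) ++ p ∷ [])
    len hd h = trans (cong length (proj₂ (hd h)))
      (sym (trans (length-++ (proj₁ (hd h))) (+-comm _ 1)))

    seg-odd : ∀ i → Odd (length (tail i zero))
    seg-odd zero = subst Odd (len₀ zero) (proj₁ (proj₂ (adjust r₅ od₅ ev₅ ℓ)))
    seg-odd (suc zero) = subst Odd (len hd₄ zero) od₄
    seg-odd (suc (suc zero)) = subst Odd (len hd₃ zero) od₃
    seg-odd (suc (suc (suc zero))) = subst Odd (len hd₂ zero) od₂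
    seg-odd (suc (suc (suc (suc zero)))) = subst Odd (len hd₁ zero) od₁

    seg-even : ∀ i → Even (length (tail i (suc zero)))
    seg-even zero = subst Even (len₀ (suc zero)) (proj₂ (proj₂ (adjust r₅ od₅ ev₅ ℓ)))
    seg-even (suc zero) = subst Even (len hd₄ (suc zero)) ev₄
    seg-even (suc (suc zero)) = subst Even (len hd₃ (suc zero)) ev₃
    seg-even (suc (suc (suc zero))) = subst Even (len hd₂ (suc zero)) ev₂
    seg-even (suc (suc (suc (suc zero)))) = subst Even (len hd₁ (suc zero)) ev₁

    -- Link `i` of the chain, counted from 0, is segment `4 - i` of the rope; the last clause is a
    -- default beyond the five links.
    turn : (Fin 5 → Fin 2) → ℕ → Fin 2
    turn hs 4 = σ (hs zero)
    turn hs 3 = hs (suc zero)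
    turn hs 2 = hs (suc (suc zero))
    turn hs 1 = hs (suc (suc (suc zero)))
    turn hs 0 = hs (suc (suc (suc (suc zero))))
    turn hs _ = zero

    cycle : (Fin 5 → Fin 2) → List V
    cycle hs = inner ++ path (turn hs) c₅

    cycle-long : ∀ hs → 3 ≤ length (cycle hs)
    cycle-long hs = subst (3 ≤_) (sym (length-++ inner {path (turn hs) c₅}))
      (≤-trans (m≤m+n 3 3) (≤-trans (path-long (turn hs) c₅)
        (m≤n+m (length (path (turn hs) c₅)) (length inner))))

    headIn : ∀ hs {i w} (c : Chain q₀ i w) → w ∈ˡ path (turn hs) c
    headIn hs c = subst (_ ∈ˡ_) (sym (proj₂ (path-head (turn hs) c))) (here refl)

    vertices⇒ : ∀ hs {y} → (∃ λ i → y ∈ˡ seg i (hs i)) → y ∈ˡ cycle hs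
    vertices⇒ hs (i , y∈) = seg⊆cycle i y∈
      where
      inPath : ∀ {i w b} (c : Chain q₀ i w) {route : Fin 2 → List V}
        (hd : ∀ h → ∃ λ s → route h ≡ b ∷ s) h {y} →
        y ∈ˡ b ∷ (proj₁ (hd h) ++ w ∷ []) → y ∈ˡ route h ++ path (turn hs) c
      inPath c {route} hd h y∈ with ∈-++⁻ (route h) (subst (_ ∈ˡ_) (sym (unfold hd h)) y∈)
      ... | inj₁ j = ∈-++⁺ˡ j
      ... | inj₂ (here refl) = ∈-++⁺ʳ (route h) (headIn hs c)
      seg⊆cycle : ∀ i {y} → y ∈ˡ seg i (hs i) → y ∈ˡ cycle hs
      seg⊆cycle zero (here refl) = ∈-++⁺ʳ inner (endsAt-∈ (path-end (turn hs) c₅))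
      seg⊆cycle zero (there y∈) with ∈-++⁻ inner y∈
      ... | inj₁ j = ∈-++⁺ˡ j
      ... | inj₂ j with ∈-++⁻ (r₅ (σ (hs zero))) j
      ...   | inj₁ k = ∈-++⁺ʳ inner (∈-++⁺ˡ k)
      ...   | inj₂ (here refl) = ∈-++⁺ʳ inner (∈-++⁺ʳ (r₅ _) (headIn hs c₄))
      seg⊆cycle (suc zero) y∈ = ∈-++⁺ʳ inner (∈-++⁺ʳ (r₅ _) (inPath c₃ hd₄ _ y∈))
      seg⊆cycle (suc (suc zero)) y∈ = ∈-++⁺ʳ inner (∈-++⁺ʳ (r₅ _) (∈-++⁺ʳ (r₄ _) (inPath c₂ hd₃ _ y∈)))
      seg⊆cycle (suc (suc (suc zero))) y∈ =
        ∈-++⁺ʳ inner (∈-++⁺ʳ (r₅ _) (∈-++⁺ʳ (r₄ _) (∈-++⁺ʳ (r₃ _) (inPath c₁ hd₂ _ y∈))))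
      seg⊆cycle (suc (suc (suc (suc zero)))) y∈ =
        ∈-++⁺ʳ inner (∈-++⁺ʳ (r₅ _) (∈-++⁺ʳ (r₄ _) (∈-++⁺ʳ (r₃ _) (∈-++⁺ʳ (r₂ _) (inPath c₀ hd₁ _ y∈)))))

    inSeg : ∀ {b p} {route : Fin 2 → List V} (hd : ∀ h → ∃ λ s → route h ≡ b ∷ s) h {y} →
      y ∈ˡ route h → y ∈ˡ b ∷ (proj₁ (hd h) ++ p ∷ [])
    inSeg hd h y∈ = subst (_ ∈ˡ_) (unfold hd h) (∈-++⁺ˡ y∈)

    vertices⇐ : ∀ hs {y} → y ∈ˡ cycle hs → ∃ λ i → y ∈ˡ seg i (hs i)
    vertices⇐ hs y∈ with ∈-++⁻ inner y∈
    ... | inj₁ j = zero , there (∈-++⁺ˡ j)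
    ... | inj₂ y∈₅ with ∈-++⁻ (r₅ (σ (hs zero))) y∈₅
    ...   | inj₁ j = zero , there (∈-++⁺ʳ inner (∈-++⁺ˡ j))
    ...   | inj₂ y∈₄ with ∈-++⁻ (r₄ (hs (suc zero))) y∈₄
    ...     | inj₁ j = suc zero , inSeg hd₄ _ j
    ...     | inj₂ y∈₃ with ∈-++⁻ (r₃ (hs (suc (suc zero)))) y∈₃
    ...       | inj₁ j = suc (suc zero) , inSeg hd₃ _ j
    ...       | inj₂ y∈₂ with ∈-++⁻ (r₂ (hs (suc (suc (suc zero))))) y∈₂
    ...         | inj₁ j = suc (suc (suc zero)) , inSeg hd₂ _ j
    ...         | inj₂ y∈₁ with ∈-++⁻ (r₁ (hs (suc (suc (suc (suc zero)))))) y∈₁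
    ...           | inj₁ j = suc (suc (suc (suc zero))) , inSeg hd₁ _ j
    ...           | inj₂ (here refl) = zero , here refl

    routeY : ∀ {b p} {route : Fin 2 → List V} (hd : ∀ h → ∃ λ s → route h ≡ b ∷ s) →
      (∀ h {y} → y ∈ˡ route h → Y y) → Y p → ∀ h {y} → y ∈ˡ b ∷ (proj₁ (hd h) ++ p ∷ []) → Y y
    routeY {route = route} hd inY Yp h y∈ with ∈-++⁻ (route h) (subst (_ ∈ˡ_) (sym (unfold hd h)) y∈)
    ... | inj₁ j = inY h j
    ... | inj₂ (here refl) = Yp

    headY : ∀ {b} {route : Fin 2 → List V} → (∀ h → ∃ λ s → route h ≡ b ∷ s) →
      (∀ h {y} → y ∈ˡ route h → Y y) → Y b
    headY hd inY = inY zero (subst (_ ∈ˡ_) (sym (proj₂ (hd zero))) (here refl))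

    seg-in : ∀ i h {y} → y ∈ˡ seg i h → Y y
    seg-in zero h (here refl) = Yq₀
    seg-in zero h (there y∈) with ∈-++⁻ inner y∈
    ... | inj₁ j = inner-in j
    ... | inj₂ j with ∈-++⁻ (r₅ (σ h)) j
    ...   | inj₁ k = y₅ (σ h) k
    ...   | inj₂ (here refl) = headY hd₄ y₄
    seg-in (suc zero) h = routeY hd₄ y₄ (headY hd₃ y₃) h
    seg-in (suc (suc zero)) h = routeY hd₃ y₃ (headY hd₂ y₂) h
    seg-in (suc (suc (suc zero))) h = routeY hd₂ y₂ (headY hd₁ y₁) h
    seg-in (suc (suc (suc (suc zero)))) h = routeY hd₁ y₁ Yq₀ h

    cycle-unique : ∀ hs → Unique (cycle hs)
    cycle-unique hs = ++⁺ (unique-++ˡ inner (unique-tail (induced-unique inner-induced)))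
      (induced-unique (path-induced (turn hs) c₅))
      λ { (y∈ , y∈′) → proj₁ (inner-off y∈ (path-on (turn hs) c₅ y∈′)) refl }
      where
      unique-tail : ∀ {x : V} {l} → Unique (x ∷ l) → Unique l
      unique-tail (_ ∷ p) = p
      unique-++ˡ : ∀ (xs : List V) {ys} → Unique (xs ++ ys) → Unique xs
      unique-++ˡ [] _ = []
      unique-++ˡ (x ∷ xs) (p ∷ ps) = All.tabulate (λ i → All.lookup p (∈-++⁺ˡ i)) ∷ unique-++ˡ xs ps

    edges⇐ : ∀ hs {u w} → Edges (q₀ ∷ cycle hs) u w → ∃ λ i → Edges (seg i (hs i)) u w
    edges⇐ hs e with path-split (turn hs) c₅ (q₀ ∷ inner) e
    ... | inj₁ j = zero , subst (λ l → Edges ((q₀ ∷ inner) ++ l) _ _) (sym (unfold hd₅ (σ (hs zero))))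
            (edges-left (q₀ ∷ inner) j)
    ... | inj₂ e₅ with path-split (turn hs) c₄ (r₅ (σ (hs zero))) e₅
    ...   | inj₁ j = zero , edges-right (q₀ ∷ inner) j
    ...   | inj₂ e₄ with path-split (turn hs) c₃ (r₄ (hs (suc zero))) e₄
    ...     | inj₁ j = suc zero , subst (λ l → Edges l _ _) (unfold hd₄ _) j
    ...     | inj₂ e₃ with path-split (turn hs) c₂ (r₃ (hs (suc (suc zero)))) e₃
    ...       | inj₁ j = suc (suc zero) , subst (λ l → Edges l _ _) (unfold hd₃ _) j
    ...       | inj₂ e₂ with path-split (turn hs) c₁ (r₂ (hs (suc (suc (suc zero))))) e₂
    ...         | inj₁ j = suc (suc (suc zero)) , subst (λ l → Edges l _ _) (unfold hd₂ _) j
    ...         | inj₂ e₁ with path-split (turn hs) c₀ (r₁ (hs (suc (suc (suc (suc zero)))))) e₁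
    ...           | inj₁ j = suc (suc (suc (suc zero))) , subst (λ l → Edges l _ _) (unfold hd₁ _) j
    ...           | inj₂ (there ())

    edges⇒ : ∀ hs {u w} → (∃ λ i → Edges (seg i (hs i)) u w) → Edges (q₀ ∷ cycle hs) u w
    edges⇒ hs {u} {w} (zero , e) with edges-split (q₀ ∷ inner)
      (subst (λ l → Edges ((q₀ ∷ inner) ++ l) u w) (unfold hd₅ (σ (hs zero))) e)
    ... | inj₁ j = path-join (turn hs) c₅ (q₀ ∷ inner) j
    ... | inj₂ j = edges-right (q₀ ∷ inner) (path-join (turn hs) c₄ (r₅ _)
            (subst (λ l → Edges l u w) (sym (unfold hd₅ (σ (hs zero)))) j))
    edges⇒ hs {u} {w} (suc zero , e) = edges-right (q₀ ∷ inner) (edges-right (r₅ _)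
      (path-join (turn hs) c₃ (r₄ _) (subst (λ l → Edges l u w) (sym (unfold hd₄ _)) e)))
    edges⇒ hs {u} {w} (suc (suc zero) , e) = edges-right (q₀ ∷ inner) (edges-right (r₅ _) (edges-right (r₄ _)
      (path-join (turn hs) c₂ (r₃ _) (subst (λ l → Edges l u w) (sym (unfold hd₃ _)) e))))
    edges⇒ hs {u} {w} (suc (suc (suc zero)) , e) =
      edges-right (q₀ ∷ inner) (edges-right (r₅ _) (edges-right (r₄ _) (edges-right (r₃ _)
      (path-join (turn hs) c₁ (r₂ _) (subst (λ l → Edges l u w) (sym (unfold hd₂ _)) e)))))
    edges⇒ hs {u} {w} (suc (suc (suc (suc zero))) , e) =
      edges-right (q₀ ∷ inner) (edges-right (r₅ _) (edges-right (r₄ _) (edges-right (r₃ _) (edges-right (r₂ _)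
      (path-join (turn hs) c₀ (r₁ _) (subst (λ l → Edges l u w) (sym (unfold hd₁ _)) e))))))

    -- The cycle is the union of two induced paths with common ends `q₀` and `v`. An edge with an
    -- end in `inner` has both ends on the closing path; every other edge lies within the chain.
    cycle-adj : ∀ hs {u w} → u ∈ˡ cycle hs → w ∈ˡ cycle hs → u ~ w →
      Edges (q₀ ∷ cycle hs) u w ⊎ Edges (q₀ ∷ cycle hs) w u
    cycle-adj hs {u} {w} u∈ w∈ e = cases (∈-++⁻ inner u∈) (∈-++⁻ inner w∈)
      where
      Goal : Set
      Goal = Edges (q₀ ∷ cycle hs) u w ⊎ Edges (q₀ ∷ cycle hs) w u
      viaClosing : u ∈ˡ q₀ ∷ inner ++ v ∷ [] → w ∈ˡ q₀ ∷ inner ++ v ∷ [] → Goal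
      viaClosing i j = [ (λ x → inj₁ (path-join (turn hs) c₅ (q₀ ∷ inner) x))
                       , (λ x → inj₂ (path-join (turn hs) c₅ (q₀ ∷ inner) x)) ]′ (induced-adj inner-induced i j e)
      onClosing : ∀ {y a} → y ∈ˡ inner → a ∈ˡ path (turn hs) c₅ → y ~ a → a ∈ˡ q₀ ∷ inner ++ v ∷ []
      onClosing {y} {a} y∈ a∈ ya with a ≟ᶠ v | a ≟ᶠ q₀
      ... | yes refl | _ = there (∈-++⁺ʳ inner (here refl))
      ... | _ | yes refl = here refl
      ... | no a≢v | no a≢q = contradiction ya (proj₂ (inner-off y∈ (path-on (turn hs) c₅ a∈)) a≢v a≢q)
      cases : u ∈ˡ inner ⊎ u ∈ˡ path (turn hs) c₅ → w ∈ˡ inner ⊎ w ∈ˡ path (turn hs) c₅ → Goal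
      cases (inj₁ i) (inj₁ j) = viaClosing (there (∈-++⁺ˡ i)) (there (∈-++⁺ˡ j))
      cases (inj₁ i) (inj₂ j) = viaClosing (there (∈-++⁺ˡ i)) (onClosing i j e)
      cases (inj₂ i) (inj₁ j) = viaClosing (onClosing j i (~-sym e)) (there (∈-++⁺ˡ j))
      cases (inj₂ i) (inj₂ j) =
        [ (λ x → inj₁ (edges-right (q₀ ∷ inner) x)) , (λ x → inj₂ (edges-right (q₀ ∷ inner) x)) ]′
          (induced-adj (path-induced (turn hs) c₅) i j e)

-- The theorem.

theorem4p6 : (G : Graph) (X : Subset (n G)) →
    OddGirth≥ G 11 → χ[ G [ X ]]≥ 99525 → ArithRope5 G X
theorem4p6 G X og χ≥ = build (initial ¬col)
  where
  -- The given set takes the place of `Y`; the `X` of links and states is a different set.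
  open Assembly G og (_∈ X) (_∈? X)
  N : ℕ
  N = seed (grow (grow (grow (grow (grow 0)))))
  ¬col : ¬ Col (_∈ X) N
  -- `N` evaluates to 36838, so the comparison is settled by computation.
  ¬col (f , bound , proper) = χ≥ N (<ᵇ⇒< N 99525 _) (g , λ u w u∈ w∈ e eq →
      proper u w u∈ w∈ e (trans (sym (val u u∈)) (trans (cong toℕ eq) (val w w∈))))
    where
    g : V → Fin N
    -- `f` is unbounded outside the set; the truncation gives a total colouring and changes nothing
    -- on the set.
    g u = fromℕ< (s≤s (m⊓n≤n (f u) (N ∸ 1)))
    val : ∀ u → u ∈ X → toℕ (g u) ≡ f u
    val u u∈ = trans (toℕ-fromℕ< _) (m≤n⇒m⊓n≡m (≤-pred (bound u u∈)))
  build : (∃ λ q → State q 0 (grow (grow (grow (grow (grow 0)))))) → ArithRope5 G X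
  build (q , S₀) = rope X (λ y∈ → y∈) (ropeLists (State.chain S₅) (State.q∈Y S₅) (closing S₅))
    where
    S₅ : State q 5 0
    S₅ = advance (advance (advance (advance (advance S₀))))
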